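{- Let $q$ be a prime power, $m,k,h$ integers with $m,k\ge1$ and $0\le h<k$, and let $n=\lfloor\frac{km}{h+1}\rfloor$; assume $k<n$ and $$km-(h+2)\left\lfloor\frac{km}{h+1}\right\rfloor<0.$$ Let $\mathcal{U}$ be an $[n,k]_{q^m/q}$ system and $\mathcal{C}$ an $[n,k]_{q^m/q}$ code associated with $\mathcal{U}$. Then $\mathcal{U}$ is quasi-maximum $h$-scattered if and only if $\mathcal{C}^\perp$ is quasi-MRD.
   Context: An $[n,k]_{q^m/q}$ code is a $k$-dimensional $\mathbb{F}_{q^m}$-subspace of $\mathbb{F}_{q^m}^n$; the rank weight of a vector is the $\mathbb{F}_q$-dimension of the $\mathbb{F}_q$-span of its entries, and $d_{\mathrm{rk}}(\mathcal{C})$ is the least rank weight of a nonzero codeword. The dual is $\mathcal{C}^\perp=\{v: cv^\top=0\ \forall c\in\mathcal{C}\}$. An $[n,k]_{q^m/q}$ system is an $n$-dimensional $\mathbb{F}_q$-subspace $\mathcal{U}\subseteq\mathbb{F}_{q^m}^k$ with $\langle\mathcal{U}\rangle_{\mathbb{F}_{q^m}}=\mathbb{F}_{q^m}^k$. The codes associated with $\mathcal{U}$ are the codes $\{vA: v\in\mathcal{D}\}$, $A\in\mathrm{GL}(n,q)$, where $\mathcal{D}$ is the row space of the $k\times n$ matrix whose columns form an $\mathbb{F}_q$-basis of $\mathcal{U}$. $\mathcal{U}$ is $h$-scattered if $\dim_{\mathbb{F}_q}(\mathcal{U}\cap W)\le h$ for every $h$-dimensional $\mathbb{F}_{q^m}$-subspace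 $W$ of $\mathbb{F}_{q^m}^k$; it is quasi-maximum $h$-scattered if it is $h$-scattered and $\dim_{\mathbb{F}_q}\mathcal{U}=\lfloor\frac{km}{h+1}\rfloor$ (the paper uses this name when $h+1\nmid km$; when $h+1\mid km$ this is the notion of maximum $h$-scattered). The Singleton rank defect of an $[N,K,d]_{q^m/q}$ code $\mathcal{D}$ is $\mathrm{Rdef}(\mathcal{D})=m-\lceil\frac{Km}{N}\rceil-d+1$, and $\mathcal{D}$ is quasi-MRD if $\mathrm{Rdef}(\mathcal{D})=0$. -}

module Defs where

open import Data.Nat as ℕ using (ℕ; zero; suc; _≤_; _<_)
open import Data.Nat.DivMod using (_/_)
open import Data.Nat.Primality using (Prime)
open import Data.Fin using (Fin; zero; suc)
open import Data.Fin.Properties using (_≟_)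
open import Data.Product using (Σ; ∃; _×_; _,_)
open import Data.Unit using (⊤)
open import Relation.Binary.PropositionalEquality using (_≡_; _≢_)
open import Relation.Nullary using (¬_; yes; no)
open import Algebra.Structures using (IsCommutativeRing)

IsPrimePower : ℕ → Set
IsPrimePower q = ∃ λ p → ∃ λ e → Prime p × q ≡ p ℕ.^ suc e

-- ceiling division ⌈ a / b ⌉ (b > 0 in all uses; value 0 if b = 0)
ceilDiv : ℕ → ℕ → ℕ
ceilDiv a zero = 0
ceilDiv a (suc b) = (a ℕ.+ b) / suc b

-- A field L (playing F_{q^m}) with a subfield K (playing F_q), given as a predicate.
record FieldExt : Set₁ where
  infixl 6 _+_
  infixl 7 _*_
  field
    L : Set
    0# 1# : L
    _+_ _*_ : L → L → L
    -_ : L → L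
    _⁻¹ : L → L
    isCommutativeRing : IsCommutativeRing _≡_ _+_ _*_ -_ 0# 1#
    0≢1 : 0# ≢ 1#
    inverse : ∀ x → x ≢ 0# → x * (x ⁻¹) ≡ 1#
    K : L → Set
    K-prop : ∀ {x} (p p′ : K x) → p ≡ p′
    K-0 : K 0#
    K-1 : K 1#
    K-+ : ∀ {x y} → K x → K y → K (x + y)
    K-* : ∀ {x y} → K x → K y → K (x * y)
    K-neg : ∀ {x} → K x → K (- x)
    K-inv : ∀ {x} → K x → x ≢ 0# → K (x ⁻¹)

-- Linear algebra over the coefficient set S ⊆ L (S = K: F_q-linear; S = everything: F_{q^m}-linear)
-- in a space V with equivalence _≈_, zero, addition and scalar multiplication by L.
module LinAlg (F : FieldExt) (V : Set) (_≈_ : V → V → Set) (0v : V) (_⊕_ : V → V → V)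
              (_·_ : FieldExt.L F → V → V) (S : FieldExt.L F → Set) where
  open FieldExt F

  lincomb : ∀ {d} → (Fin d → L) → (Fin d → V) → V
  lincomb {zero} c b = 0v
  lincomb {suc d} c b = (c zero · b zero) ⊕ lincomb (λ i → c (suc i)) (λ i → b (suc i))

  InSpan : ∀ {d} → (Fin d → V) → V → Set
  InSpan {d} b x = Σ (Fin d → L) λ c → (∀ i → S (c i)) × (lincomb c b ≈ x)

  InSpanSet : (V → Set) → V → Set
  InSpanSet U x = ∃ λ d → Σ (Fin d → V) λ b → (∀ i → U (b i)) × InSpan b x

  Independent : ∀ {d} → (Fin d → V) → Set
  Independent {d} b = ∀ (c : Fin d → L) → (∀ i → S (c i)) → lincomb c b ≈ 0v → ∀ i → c i ≡ 0#

  IsBasis : ∀ {d} → (V → Set) → (Fin d → V) → Set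
  IsBasis U b = (∀ i → U (b i)) × Independent b × (∀ x → U x → InSpan b x) × (∀ x → InSpan b x → U x)

  HasDim : (V → Set) → ℕ → Set
  HasDim U d = Σ (Fin d → V) λ b → IsBasis U b

module _ (F : FieldExt) where
  open FieldExt F

  Vect : ℕ → Set
  Vect n = Fin n → L

  _≈v_ : ∀ {n} → Vect n → Vect n → Set
  x ≈v y = ∀ i → x i ≡ y i

  0v : ∀ {n} → Vect n
  0v _ = 0#

  _⊕v_ : ∀ {n} → Vect n → Vect n → Vect n
  (x ⊕v y) i = x i + y i

  _·v_ : ∀ {n} → L → Vect n → Vect n
  (a ·v x) i = a * x i

  ∑ : ∀ {d} → (Fin d → L) → L
  ∑ {zero} f = 0#
  ∑ {suc d} f = f zero + ∑ (λ i → f (suc i))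

  module KonL = LinAlg F L _≡_ 0# _+_ _*_ K
  module KonV (n : ℕ) = LinAlg F (Vect n) _≈v_ 0v _⊕v_ _·v_ K
  module LonV (n : ℕ) = LinAlg F (Vect n) _≈v_ 0v _⊕v_ _·v_ (λ _ → ⊤)

  NonZero : ∀ {n} → Vect n → Set
  NonZero x = ∃ λ i → x i ≢ 0#

  RankWeight : ∀ {N} → Vect N → ℕ → Set
  RankWeight x w = KonL.HasDim (KonL.InSpan x) w

  MinRankDist : ∀ {N} → (Vect N → Set) → ℕ → Set
  MinRankDist D d =
    (∃ λ c → D c × NonZero c × RankWeight c d) ×
    (∀ c w → D c → NonZero c → RankWeight c w → d ≤ w)

  -- quasi-MRD: Rdef(D) = m - ⌈Km/N⌉ - d + 1 = 0, with K = dim D, d = d_rk(D)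
  QuasiMRD : (m N : ℕ) → (Vect N → Set) → Set
  QuasiMRD m N D = ∃ λ Kd → ∃ λ d →
    LonV.HasDim N D Kd × MinRankDist D d × (d ℕ.+ ceilDiv (Kd ℕ.* m) N ≡ m ℕ.+ 1)

  Dual : ∀ {N} → (Vect N → Set) → Vect N → Set
  Dual C y = ∀ c → C c → ∑ (λ i → c i * y i) ≡ 0#

  cols : ∀ {k n} → (Fin k → Fin n → L) → Fin n → Vect k
  cols G j i = G i j

  IsSystem : (n k : ℕ) → (Vect k → Set) → Set
  IsSystem n k U = KonV.HasDim k U n × (∀ x → LonV.InSpanSet k U x)

  HScattered : (k h : ℕ) → (Vect k → Set) → Set₁
  HScattered k h U = ∀ (W : Vect k → Set) → LonV.HasDim k W h →
    ∀ d → KonV.HasDim k (λ x → U x × W x) d → d ≤ h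

  QuasiMaxHScattered : (m k h : ℕ) → (Vect k → Set) → Set₁
  QuasiMaxHScattered m k h U = HScattered k h U × KonV.HasDim k U ((k ℕ.* m) / suc h)

  δ : ∀ {n} → Fin n → Fin n → L
  δ i j with i ≟ j
  ... | yes _ = 1#
  ... | no _ = 0#

  matMul : ∀ {a b c} → (Fin a → Fin b → L) → (Fin b → Fin c → L) → Fin a → Fin c → L
  matMul X Y i l = ∑ (λ j → X i j * Y j l)

  InGL : (n : ℕ) → (Fin n → Fin n → L) → Set
  InGL n A = (∀ i j → K (A i j)) × Σ (Fin n → Fin n → L) λ B → (∀ i j → K (B i j)) ×
    (∀ i j → matMul A B i j ≡ δ i j) × (∀ i j → matMul B A i j ≡ δ i j)

  CodeOf : ∀ {k n} → (Fin k → Fin n → L) → (Fin n → Fin n → L) → Vect n → Set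
  CodeOf {k} G A x = Σ (Vect k) λ v → ∀ l → x l ≡ matMul {1} (λ _ → v) (matMul G A) zero l

{-# OPTIONS --safe #-}
-- Put H = GA. Its columns form again a K-basis of U, and the dual code is the kernel of H.
-- Since (h+1)n ≤ km < (h+2)n, one has ⌈(n-k)m/n⌉ = m-h-1, so the dual code is quasi-MRD exactly
-- when its minimum distance is h+2; by the Singleton bound it is never larger.
-- A word z of rank weight w factors as z = Mu with u ∈ Lʷ independent over K and M ∈ Kⁿˣʷ of rank w,
-- and Hz = 0 says that the w columns of HM, which are K-independent vectors of U, satisfy the L-linear
-- relation u. Hence nonzero words of weight ≤ h+1 correspond to h+1 K-independent vectors of U that are
-- L-dependent, i.e. lie in a common h-dimensional L-subspace, which is what h-scattered excludes.
-- Everything is finite, so spans are decidable and dimensions are compared by the pigeonhole principle.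
module Submission where

open import Defs
open import Algebra.Bundles using (CommutativeRing; CommutativeSemigroup; Semiring)
open import Algebra.Module.Bundles using (LeftSemimodule)
open import Algebra.Module.Construct.TensorUnit using (leftSemimodule)
open import Algebra.Module.Structures using (IsLeftSemimodule)
import Algebra.Properties.CommutativeSemigroup as CommutativeSemigroupProperties
open import Algebra.Structures using (IsCommutativeMonoid)
open import Data.Fin.Base as Fin using (Fin; zero; suc; finToFun; funToFin; _↑ˡ_; _↑ʳ_)
open import Data.Fin.Properties using (any?; all?; pigeonhole; finToFun-funToFin; funToFin-finToFin; inj⇒≟)
import Data.Fin.Properties as Fin
open import Data.Nat using (ℕ; zero; suc; _≤_; _<_; _*_; _+_; _^_; _/_; _∸_; >-nonZero; z≤n; s≤s; _≤′_; ≤′-refl; ≤′-step)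
import Data.Nat.Properties as ℕ
open import Data.Nat.DivMod using (m/n*n≤m; m*n/n≡m; m<n⇒m/n≡0; +-distrib-/-∣ˡ)
open import Data.Nat.Divisibility using (n∣m*n)
open import Data.Product using (Σ; ∃; _×_; _,_; proj₁; proj₂)
open import Data.Sum using (_⊎_; inj₁; inj₂)
open import Data.Unit using (⊤; tt)
open import Data.Vec.Functional using (_∷_; []; _++_)
open import Data.Vec.Functional.Properties using (lookup-++ˡ; lookup-++ʳ)
open import Function.Base using (_∘_)
open import Function.Bundles using (_↔_; _⇔_; Inverse; mk⇔; mk↔ₛ′)
open import Function.Properties.Inverse using (Inverse⇒Injection; ↔-sym)
open import Relation.Binary.Definitions using (Decidable; DecidableEquality)
import Relation.Binary.Reasoning.Setoid as SetoidReasoning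
open import Relation.Binary.PropositionalEquality using (_≡_; _≢_; _≗_; refl; sym; trans; cong; cong₂; subst; subst₂; module ≡-Reasoning)
open import Relation.Nullary using (¬_; Dec; yes; no; map′; contradiction)
open import Relation.Nullary.Decidable using (_×-dec_)
open FieldExt using (L; K)

-- Finite fields of scalars

commutativeRing : FieldExt → CommutativeRing _ _
commutativeRing F = record { isCommutativeRing = FieldExt.isCommutativeRing F }

semiring : FieldExt → Semiring _ _
semiring F = CommutativeRing.semiring (commutativeRing F)

-- Instantiated with K and with L itself.
record FiniteSubfield (F : FieldExt) : Set₁ where
  open FieldExt F using (0#; 1#; -_; _⁻¹) renaming (_+_ to _⊞_; _*_ to _⊠_)
  field
    S : L F → Set
    S-irrelevant : ∀ {x} (p p′ : S x) → p ≡ p′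
    S-0 : S 0#
    S-1 : S 1#
    S-+ : ∀ {x y} → S x → S y → S (x ⊞ y)
    S-* : ∀ {x y} → S x → S y → S (x ⊠ y)
    S-neg : ∀ {x} → S x → S (- x)
    S-inv : ∀ {x} → S x → x ≢ 0# → S (x ⁻¹)
    size : ℕ
    enum : Fin size ↔ Σ (L F) S

  S-∑ : ∀ {d} {f : Fin d → L F} → (∀ i → S (f i)) → S (∑ F f)
  S-∑ {zero} Sf = S-0
  S-∑ {suc d} Sf = S-+ (Sf zero) (S-∑ (Sf ∘ suc))

  S-δ : ∀ {d} (i j : Fin d) → S (δ F i j)
  S-δ i j with i Fin.≟ j
  ... | yes _ = S-1
  ... | no _ = S-0

-- Linear algebra over a finite subfield

module LinearAlgebra (F : FieldExt) (_≟_ : DecidableEquality (L F)) (Sc : FiniteSubfield F)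
                     (V : Set) (_≈_ : V → V → Set) (_≈?_ : Decidable _≈_) (0v : V) (_⊕_ : V → V → V)
                     (_·_ : L F → V → V) (isV : IsLeftSemimodule (semiring F) _≈_ _⊕_ 0v _·_) where

  open FieldExt F using (0#; 1#; -_; _⁻¹; 0≢1; inverse) renaming (_+_ to _⊞_; _*_ to _⊠_)
  private module R = CommutativeRing (commutativeRing F)
  open FiniteSubfield Sc
  open IsLeftSemimodule isV
  open LinAlg F V _≈_ 0v _⊕_ _·_ S public
  open SetoidReasoning ≈ᴹ-setoid

  ⊕-commutativeSemigroup : CommutativeSemigroup _ _
  ⊕-commutativeSemigroup = record
    { isCommutativeSemigroup = IsCommutativeMonoid.isCommutativeSemigroup +ᴹ-isCommutativeMonoid }

  open CommutativeSemigroupProperties ⊕-commutativeSemigroup using (interchange)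

  -- Calculus of linear combinations

  lincomb-cong : ∀ {d} {c c′ : Fin d → L F} {b b′ : Fin d → V} →
    c ≗ c′ → (∀ i → b i ≈ b′ i) → lincomb c b ≈ lincomb c′ b′
  lincomb-cong {zero} c≗ b≈ = ≈ᴹ-refl
  lincomb-cong {suc d} c≗ b≈ =
    +ᴹ-cong (*ₗ-cong (c≗ zero) (b≈ zero)) (lincomb-cong (c≗ ∘ suc) (b≈ ∘ suc))

  lincomb-+ : ∀ {d} (c c′ : Fin d → L F) (b : Fin d → V) →
    lincomb (λ i → c i ⊞ c′ i) b ≈ (lincomb c b ⊕ lincomb c′ b)
  lincomb-+ {zero} c c′ b = ≈ᴹ-sym (+ᴹ-identityˡ 0v)
  lincomb-+ {suc d} c c′ b = ≈ᴹ-trans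
    (+ᴹ-cong (*ₗ-distribʳ (b zero) (c zero) (c′ zero)) (lincomb-+ (c ∘ suc) (c′ ∘ suc) (b ∘ suc)))
    (interchange _ _ _ _)

  lincomb-* : ∀ {d} a (c : Fin d → L F) (b : Fin d → V) →
    lincomb (λ i → a ⊠ c i) b ≈ (a · lincomb c b)
  lincomb-* {zero} a c b = ≈ᴹ-sym (*ₗ-zeroʳ a)
  lincomb-* {suc d} a c b = ≈ᴹ-trans
    (+ᴹ-cong (*ₗ-assoc a (c zero) (b zero)) (lincomb-* a (c ∘ suc) (b ∘ suc)))
    (≈ᴹ-sym (*ₗ-distribˡ a _ _))

  lincomb-zeroˡ : ∀ {d} {c : Fin d → L F} (b : Fin d → V) → (∀ i → c i ≡ 0#) → lincomb c b ≈ 0v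
  lincomb-zeroˡ {zero} b c≡0 = ≈ᴹ-refl
  lincomb-zeroˡ {suc d} b c≡0 = ≈ᴹ-trans
    (+ᴹ-cong (≈ᴹ-trans (*ₗ-congʳ (c≡0 zero)) (*ₗ-zeroˡ (b zero))) (lincomb-zeroˡ (b ∘ suc) (c≡0 ∘ suc)))
    (+ᴹ-identityˡ 0v)

  lincomb-zeroʳ : ∀ {d} (c : Fin d → L F) {b : Fin d → V} → (∀ i → b i ≈ 0v) → lincomb c b ≈ 0v
  lincomb-zeroʳ {zero} c b≈0 = ≈ᴹ-refl
  lincomb-zeroʳ {suc d} c b≈0 = ≈ᴹ-trans
    (+ᴹ-cong (≈ᴹ-trans (*ₗ-congˡ (b≈0 zero)) (*ₗ-zeroʳ (c zero))) (lincomb-zeroʳ (c ∘ suc) (b≈0 ∘ suc)))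
    (+ᴹ-identityˡ 0v)

  -- Associativity c(Mb) = (cM)b for a coefficient matrix `M`; the matrix factorisations below are
  -- manipulated through it.
  lincomb-lincomb : ∀ {d e} (c : Fin d → L F) (M : Fin d → Fin e → L F) (b : Fin e → V) →
    lincomb c (λ i → lincomb (M i) b) ≈ lincomb (λ j → ∑ F (λ i → c i ⊠ M i j)) b
  lincomb-lincomb {zero} c M b = ≈ᴹ-sym (lincomb-zeroˡ b (λ _ → refl))
  lincomb-lincomb {suc d} c M b = ≈ᴹ-trans
    (+ᴹ-cong (≈ᴹ-sym (lincomb-* (c zero) (M zero) b)) (lincomb-lincomb (c ∘ suc) (M ∘ suc) b))
    (≈ᴹ-sym (lincomb-+ _ _ b))

  lincomb-δ : ∀ {d} (i : Fin d) (b : Fin d → V) → lincomb (δ F i) b ≈ b i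
  lincomb-δ zero b = ≈ᴹ-trans
    (+ᴹ-cong (*ₗ-identityˡ (b zero)) (lincomb-zeroˡ (b ∘ suc) (λ _ → refl))) (+ᴹ-identityʳ (b zero))
  lincomb-δ (suc i) b = ≈ᴹ-trans
    (+ᴹ-cong (*ₗ-zeroˡ (b zero)) (≈ᴹ-trans (lincomb-cong (δ-suc i) (λ _ → ≈ᴹ-refl)) (lincomb-δ i (b ∘ suc))))
    (+ᴹ-identityˡ (b (suc i)))
    where
    δ-suc : ∀ {d} (i j : Fin d) → δ F (suc i) (suc j) ≡ δ F i j
    δ-suc i j with i Fin.≟ j
    ... | yes _ = refl
    ... | no _ = refl

  lincomb-++ : ∀ {d e} (c : Fin (d + e) → L F) (a : Fin d → V) (b : Fin e → V) →
    lincomb c (a ++ b) ≈ (lincomb (λ i → c (i ↑ˡ e)) a ⊕ lincomb (λ i → c (d ↑ʳ i)) b)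
  lincomb-++ {zero} c a b = ≈ᴹ-sym (+ᴹ-identityˡ _)
  lincomb-++ {suc d} {e} c a b = ≈ᴹ-trans
    (+ᴹ-congˡ (≈ᴹ-trans (lincomb-cong (λ _ → refl) tail-++) (lincomb-++ (c ∘ suc) (a ∘ suc) b)))
    (≈ᴹ-sym (+ᴹ-assoc _ _ _))
    where
    tail-++ : ∀ i → (a ++ b) (suc i) ≈ ((a ∘ suc) ++ b) i
    tail-++ i with Fin.splitAt d i
    ... | inj₁ _ = ≈ᴹ-refl
    ... | inj₂ _ = ≈ᴹ-refl

  -- `V` comes with no negation of its own; multiplication by the scalar `- 1#` takes its place.
  ⊕-inverseʳ : ∀ x → (x ⊕ ((- 1#) · x)) ≈ 0v
  ⊕-inverseʳ x = begin
    x ⊕ ((- 1#) · x)          ≈⟨ +ᴹ-congʳ (*ₗ-identityˡ x) ⟨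
    (1# · x) ⊕ ((- 1#) · x)   ≈⟨ *ₗ-distribʳ x 1# (- 1#) ⟨
    (1# ⊞ (- 1#)) · x         ≈⟨ *ₗ-congʳ (R.-‿inverseʳ 1#) ⟩
    0# · x                    ≈⟨ *ₗ-zeroˡ x ⟩
    0v                        ∎

  -- Turns two coinciding combinations, as the pigeonhole principle produces them, into one linear
  -- relation.
  lincomb-difference : ∀ {d} (c c′ : Fin d → L F) (b : Fin d → V) → lincomb c b ≈ lincomb c′ b →
    lincomb (λ i → c i ⊞ (- 1#) ⊠ c′ i) b ≈ 0v
  lincomb-difference c c′ b eq = begin
    lincomb (λ i → c i ⊞ (- 1#) ⊠ c′ i) b               ≈⟨ lincomb-+ c _ b ⟩
    lincomb c b ⊕ lincomb (λ i → (- 1#) ⊠ c′ i) b       ≈⟨ +ᴹ-congˡ (lincomb-* (- 1#) c′ b) ⟩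
    lincomb c b ⊕ ((- 1#) · lincomb c′ b)               ≈⟨ +ᴹ-congʳ eq ⟩
    lincomb c′ b ⊕ ((- 1#) · lincomb c′ b)              ≈⟨ ⊕-inverseʳ _ ⟩
    0v                                                  ∎

  difference≡0 : ∀ {x y} → x ⊞ (- 1#) ⊠ y ≡ 0# → x ≡ y
  difference≡0 {x} {y} eq = x∙y⁻¹≈ε⇒x≈y x y (trans (cong (x ⊞_) (sym (-1*x≈-x y))) eq)
    where
    open import Algebra.Properties.Ring R.ring using (-1*x≈-x)
    open import Algebra.Properties.Group R.+-group using (x∙y⁻¹≈ε⇒x≈y)

  independent-unique : ∀ {d} {b : Fin d → V} → Independent b → ∀ {c c′} → (∀ i → S (c i)) → (∀ i → S (c′ i)) →
    lincomb c b ≈ lincomb c′ b → c ≗ c′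
  independent-unique {b = b} ind {c} {c′} Sc Sc′ eq i = difference≡0
    (ind _ (λ i → S-+ (Sc i) (S-* (S-neg S-1) (Sc′ i))) (lincomb-difference c c′ b eq) i)

  -- Subspaces and spans

  record IsSubspace (P : V → Set) : Set where
    field
      resp : ∀ {x y} → x ≈ y → P x → P y
      P-0 : P 0v
      P-⊕ : ∀ {x y} → P x → P y → P (x ⊕ y)
      P-· : ∀ {a x} → S a → P x → P (a · x)

    lincomb-closed : ∀ {d} {c : Fin d → L F} {b : Fin d → V} →
      (∀ i → S (c i)) → (∀ i → P (b i)) → P (lincomb c b)
    lincomb-closed {zero} Sc Pb = P-0
    lincomb-closed {suc d} Sc Pb = P-⊕ (P-· (Sc zero) (Pb zero)) (lincomb-closed (Sc ∘ suc) (Pb ∘ suc))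

    span-⊆ : ∀ {d} {b : Fin d → V} → (∀ i → P (b i)) → ∀ x → InSpan b x → P x
    span-⊆ Pb x (c , Sc , eq) = resp eq (lincomb-closed Sc Pb)

  open IsSubspace public

  span-isSubspace : ∀ {d} (b : Fin d → V) → IsSubspace (InSpan b)
  span-isSubspace b = record
    { resp = λ { x≈y (c , Sc , eq) → c , Sc , ≈ᴹ-trans eq x≈y }
    ; P-0 = (λ _ → 0#) , (λ _ → S-0) , lincomb-zeroˡ b (λ _ → refl)
    ; P-⊕ = λ { (c , Sc , eq) (c′ , Sc′ , eq′) →
        (λ i → c i ⊞ c′ i) , (λ i → S-+ (Sc i) (Sc′ i)) , ≈ᴹ-trans (lincomb-+ c c′ b) (+ᴹ-cong eq eq′) }
    ; P-· = λ { {a} Sa (c , Sc , eq) →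
        (λ i → a ⊠ c i) , (λ i → S-* Sa (Sc i)) , ≈ᴹ-trans (lincomb-* a c b) (*ₗ-congˡ eq) }
    }

  ∩-isSubspace : ∀ {P Q} → IsSubspace P → IsSubspace Q → IsSubspace (λ x → P x × Q x)
  ∩-isSubspace p q = record
    { resp = λ { x≈y (px , qx) → resp p x≈y px , resp q x≈y qx }
    ; P-0 = P-0 p , P-0 q
    ; P-⊕ = λ { (px , qx) (py , qy) → P-⊕ p px py , P-⊕ q qx qy }
    ; P-· = λ { Sa (px , qx) → P-· p Sa px , P-· q Sa qx }
    }

  ∈-span : ∀ {d} (b : Fin d → V) i → InSpan b (b i)
  ∈-span b i = δ F i , S-δ i , lincomb-δ i b

  span-trans : ∀ {d e} {a : Fin d → V} {b : Fin e → V} → (∀ i → InSpan b (a i)) → ∀ {x} → InSpan a x → InSpan b x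
  span-trans {b = b} a⊆b {x} = span-⊆ (span-isSubspace b) a⊆b x

  span-∷ : ∀ {d} y {b : Fin d → V} {x} → InSpan b x → InSpan (y ∷ b) x
  span-∷ y {b} = span-trans {a = b} {b = y ∷ b} (λ i → ∈-span (y ∷ b) (suc i))

  basis-isSubspace : ∀ {U d} {b : Fin d → V} → IsBasis U b → IsSubspace U
  basis-isSubspace {U} {b = b} (_ , _ , U⊆span , span⊆U) = record
    { resp = λ {x} {y} x≈y Ux → span⊆U y (resp sp x≈y (U⊆span x Ux))
    ; P-0 = span⊆U 0v (P-0 sp)
    ; P-⊕ = λ {x} {y} Ux Uy → span⊆U (x ⊕ y) (P-⊕ sp (U⊆span x Ux) (U⊆span y Uy))
    ; P-· = λ {a} {x} Sa Ux → span⊆U (a · x) (P-· sp Sa (U⊆span x Ux))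
    }
    where sp = span-isSubspace b

  independent⇒spanBasis : ∀ {d} {b : Fin d → V} → Independent b → IsBasis (InSpan b) b
  independent⇒spanBasis {b = b} ind = ∈-span b , ind , (λ _ p → p) , (λ _ p → p)

  -- Counting coefficient vectors

  opaque
    -- Numbers the vectors with `d` entries in `S` by their digits in base `size`. The numbering is
    -- bijective up to pointwise equality, so spans can be searched and vectors counted.
    coefficients : ∀ d → Fin (size ^ d) → Fin d → L F
    coefficients d j i = proj₁ (Inverse.to enum (finToFun j i))

    S-coefficients : ∀ d (j : Fin (size ^ d)) i → S (coefficients d j i)
    S-coefficients d j i = proj₂ (Inverse.to enum (finToFun j i))

    code : ∀ {d} (c : Fin d → L F) → (∀ i → S (c i)) → Fin (size ^ d)
    code c Sc = funToFin (λ i → Inverse.from enum (c i , Sc i))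

    coefficients-code : ∀ {d} (c : Fin d → L F) Sc → coefficients d (code c Sc) ≗ c
    coefficients-code c Sc i = trans
      (cong (proj₁ ∘ Inverse.to enum) (finToFun-funToFin (λ i → Inverse.from enum (c i , Sc i)) i))
      (cong proj₁ (Inverse.strictlyInverseˡ enum (c i , Sc i)))

    funToFin-cong : ∀ {m n} {f g : Fin m → Fin n} → f ≗ g → funToFin f ≡ funToFin g
    funToFin-cong {zero} f≗g = refl
    funToFin-cong {suc m} f≗g = cong₂ Fin.combine (f≗g zero) (funToFin-cong (f≗g ∘ suc))

    coefficients-injective : ∀ {d} {i j : Fin (size ^ d)} → coefficients d i ≗ coefficients d j → i ≡ j
    coefficients-injective {d} {i} {j} eq = trans (sym (funToFin-finToFin {d} i))
      (trans (funToFin-cong digits) (funToFin-finToFin {d} j))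
      where
      -- Membership in `S` has at most one proof, so a scalar determines its index.
      Σ-≡ : ∀ {x y : Σ (L F) S} → proj₁ x ≡ proj₁ y → x ≡ y
      Σ-≡ {x , p} {x , p′} refl = cong (x ,_) (S-irrelevant p p′)
      digits : finToFun {size} {d} i ≗ finToFun j
      digits k = trans (sym (Inverse.strictlyInverseʳ enum _))
        (trans (cong (Inverse.from enum) (Σ-≡ (eq k))) (Inverse.strictlyInverseʳ enum _))

  opaque
    -- The two colliding indices are distinct, so their coefficient vectors differ; decidable
    -- equality in `L` locates an entry where they do.
    collision : ∀ {d N} → N < size ^ d → (f : Fin (size ^ d) → Fin N) →
      ∃ λ i → ∃ λ j → f i ≡ f j × ∃ λ k → coefficients d i k ≢ coefficients d j k
    collision {d} N< f with pigeonhole N< f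
    ... | i , j , i<j , eq = i , j , eq ,
      Fin.¬∀⟶∃¬ d _ (λ k → coefficients d i k ≟ coefficients d j k)
        (λ same → Fin.<⇒≢ i<j (coefficients-injective {d} same))

  opaque
    -- `0#` and `1#` lie in `S` and are distinct, so they need two indices. This makes the powers of
    -- `size` strictly increasing.
    1<size : 1 < size
    1<size = ℕ.≰⇒> λ size≤1 → absurd (pigeonhole (s≤s size≤1) constants)
      where
      constants : Fin 2 → Fin size
      constants zero = Inverse.from enum (0# , S-0)
      constants (suc _) = Inverse.from enum (1# , S-1)
      absurd : ¬ (∃ λ i → ∃ λ j → i Fin.< j × constants i ≡ constants j)
      absurd (zero , suc zero , _ , eq) = 0≢1 (cong proj₁
        (trans (sym (Inverse.strictlyInverseˡ enum (0# , S-0)))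
          (trans (cong (Inverse.to enum) eq) (Inverse.strictlyInverseˡ enum (1# , S-1)))))
      absurd (suc zero , suc zero , s≤s () , _)

  opaque
    -- There are only `size ^ d` coefficient vectors, and all of them are tried.
    inSpan? : ∀ {d} (b : Fin d → V) x → Dec (InSpan b x)
    inSpan? {d} b x = map′
      (λ { (j , eq) → coefficients d j , S-coefficients d j , eq })
      (λ { (c , Sc , eq) → code c Sc ,
        ≈ᴹ-trans (lincomb-cong (coefficients-code c Sc) (λ _ → ≈ᴹ-refl)) eq })
      (any? (λ j → lincomb (coefficients d j) b ≈? x))

  opaque
    -- Distinct coefficient vectors for b cannot all have distinct coefficient vectors for a.
    dependence : ∀ {d e} {a : Fin e → V} {b : Fin d → V} → e < d → (∀ i → InSpan a (b i)) →
      Σ (Fin d → L F) λ c → (∀ i → S (c i)) × lincomb c b ≈ 0v × ∃ λ i → c i ≢ 0#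
    dependence {d} {e} {a} {b} e<d b⊆a = conclude (collision {d} (ℕ.^-monoʳ-< size 1<size e<d) encode)
      where
      expand : (i : Fin (size ^ d)) → InSpan a (lincomb (coefficients d i) b)
      expand i = lincomb-closed (span-isSubspace a) (S-coefficients d i) b⊆a
      encode : Fin (size ^ d) → Fin (size ^ e)
      encode i = code (proj₁ (expand i)) (proj₁ (proj₂ (expand i)))
      decode : ∀ i → lincomb (coefficients e (encode i)) a ≈ lincomb (coefficients d i) b
      decode i = ≈ᴹ-trans (lincomb-cong (coefficients-code (proj₁ (expand i)) (proj₁ (proj₂ (expand i)))) (λ _ → ≈ᴹ-refl))
        (proj₂ (proj₂ (expand i)))
      conclude : (∃ λ i → ∃ λ j → encode i ≡ encode j × ∃ λ k → coefficients d i k ≢ coefficients d j k) →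
        Σ (Fin d → L F) λ c → (∀ i → S (c i)) × lincomb c b ≈ 0v × ∃ λ i → c i ≢ 0#
      conclude (i , j , eq , k , differ) =
        (λ l → coefficients d i l ⊞ (- 1#) ⊠ coefficients d j l) ,
        (λ l → S-+ (S-coefficients d i l) (S-* (S-neg S-1) (S-coefficients d j l))) ,
        lincomb-difference (coefficients d i) (coefficients d j) b equal , k , λ cₖ≡0 → differ (difference≡0 cₖ≡0)
        where
        equal : lincomb (coefficients d i) b ≈ lincomb (coefficients d j) b
        equal = begin
          lincomb (coefficients d i) b            ≈⟨ decode i ⟨
          lincomb (coefficients e (encode i)) a   ≡⟨ cong (λ c → lincomb (coefficients e c) a) eq ⟩
          lincomb (coefficients e (encode j)) a   ≈⟨ decode j ⟩
          lincomb (coefficients d j) b            ∎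

  -- Comparing dimensions

  dependent : ∀ {d e} {a : Fin e → V} {b : Fin d → V} → e < d → (∀ i → InSpan a (b i)) → ¬ Independent b
  dependent {a = a} {b} e<d b⊆a ind with dependence {a = a} {b} e<d b⊆a
  ... | c , Sc , eq , i , cᵢ≢0 = cᵢ≢0 (ind c Sc eq i)

  -- Counting replaces exchange: for `e < d` the relation found by `dependence` contradicts
  -- independence.
  steinitz : ∀ {d e} {a : Fin e → V} {b : Fin d → V} → Independent b → (∀ i → InSpan a (b i)) → d ≤ e
  steinitz {a = a} {b} ind b⊆a = ℕ.≮⇒≥ (λ e<d → dependent {a = a} {b} e<d b⊆a ind)

  dim-unique : ∀ {U d e} → HasDim U d → HasDim U e → d ≡ e
  dim-unique (b , b∈U , b-ind , U⊆b , _) (b′ , b′∈U , b′-ind , U⊆b′ , _) = ℕ.≤-antisym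
    (steinitz {a = b′} {b} b-ind (λ i → U⊆b′ _ (b∈U i))) (steinitz {a = b} {b′} b′-ind (λ i → U⊆b _ (b′∈U i)))

  hasDim-resp : ∀ {P Q d} → (∀ x → P x → Q x) → (∀ x → Q x → P x) → HasDim P d → HasDim Q d
  hasDim-resp P⊆Q Q⊆P (b , b∈P , b-ind , P⊆span , span⊆P) =
    b , (λ i → P⊆Q (b i) (b∈P i)) , b-ind , (λ x Qx → P⊆span x (Q⊆P x Qx)) , (λ x x∈ → P⊆Q x (span⊆P x x∈))

  -- Building and extending independent families

  independent-[] : Independent {0} []
  independent-[] c _ _ ()

  -- A relation with nonzero head coefficient could be divided by it without leaving `S`, which
  -- would put `x` into the span of `b`.
  independent-∷ : ∀ {d x} {b : Fin d → V} → Independent b → ¬ InSpan b x → Independent (x ∷ b)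
  independent-∷ {d} {x} {b} ind x∉ c Sc eq = vanish
    where
    y = lincomb (c ∘ suc) b
    c₀≡0 : c zero ≡ 0#
    c₀≡0 with c zero ≟ 0#
    ... | yes c₀≡0 = c₀≡0
    ... | no c₀≢0 = contradiction x∈ x∉
      where
      c₀⁻¹ = c zero ⁻¹
      c₀x≈ : (c zero · x) ≈ ((- 1#) · y)
      c₀x≈ = begin
        c zero · x                              ≈⟨ +ᴹ-identityʳ _ ⟨
        (c zero · x) ⊕ 0v                       ≈⟨ +ᴹ-congˡ (⊕-inverseʳ y) ⟨
        (c zero · x) ⊕ (y ⊕ ((- 1#) · y))       ≈⟨ +ᴹ-assoc _ _ _ ⟨
        ((c zero · x) ⊕ y) ⊕ ((- 1#) · y)       ≈⟨ +ᴹ-congʳ eq ⟩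
        0v ⊕ ((- 1#) · y)                       ≈⟨ +ᴹ-identityˡ _ ⟩
        (- 1#) · y                              ∎
      x≈ : (c₀⁻¹ · ((- 1#) · y)) ≈ x
      x≈ = begin
        c₀⁻¹ · ((- 1#) · y)      ≈⟨ *ₗ-congˡ c₀x≈ ⟨
        c₀⁻¹ · (c zero · x)      ≈⟨ *ₗ-assoc _ _ _ ⟨
        (c₀⁻¹ ⊠ c zero) · x      ≈⟨ *ₗ-congʳ (trans (R.*-comm _ _) (inverse _ c₀≢0)) ⟩
        1# · x                   ≈⟨ *ₗ-identityˡ x ⟩
        x                        ∎
      x∈ : InSpan b x
      x∈ = resp sp x≈ (P-· sp (S-inv (Sc zero) c₀≢0) (P-· sp (S-neg S-1) (c ∘ suc , Sc ∘ suc , ≈ᴹ-refl)))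
        where sp = span-isSubspace b
    vanish : ∀ i → c i ≡ 0#
    vanish zero = c₀≡0
    vanish (suc i) = ind (c ∘ suc) (Sc ∘ suc) (begin
      y                    ≈⟨ +ᴹ-identityˡ y ⟨
      0v ⊕ y               ≈⟨ +ᴹ-congʳ (*ₗ-zeroˡ x) ⟨
      (0# · x) ⊕ y         ≈⟨ +ᴹ-congʳ (*ₗ-congʳ c₀≡0) ⟨
      (c zero · x) ⊕ y     ≈⟨ eq ⟩
      0v                   ∎) i

  independent⇒≉0 : ∀ {d} {b : Fin d → V} → Independent b → ∀ i → ¬ (b i ≈ 0v)
  independent⇒≉0 {b = b} ind i bᵢ≈0 = 0≢1 (trans (sym (ind (δ F i) (S-δ i) (≈ᴹ-trans (lincomb-δ i b) bᵢ≈0) i)) (δ-refl i))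
    where
    δ-refl : ∀ {d} (i : Fin d) → δ F i i ≡ 1#
    δ-refl i with i Fin.≟ i
    ... | yes _ = refl
    ... | no i≢i = contradiction refl i≢i

  opaque
    -- Scans from the end and keeps a vector only if it lies outside the span of those already kept.
    -- The kept vectors are literally entries of `x`, so properties of the entries carry over by
    -- substitution.
    basisOfSpan : ∀ {N} (x : Fin N → V) → ∃ λ d → Σ (Fin d → V) λ b →
      Independent b × (∀ i → ∃ λ j → b i ≡ x j) × (∀ j → InSpan b (x j))
    basisOfSpan {zero} x = 0 , [] , independent-[] , (λ ()) , (λ ())
    basisOfSpan {suc N} x with basisOfSpan (x ∘ suc)
    ... | d , b , ind , b⊆x , x⊆b with inSpan? b (x zero)
    ... | yes x₀∈ = d , b , ind , (λ i → suc (proj₁ (b⊆x i)) , proj₂ (b⊆x i)) ,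
      λ { zero → x₀∈ ; (suc j) → x⊆b j }
    ... | no x₀∉ = suc d , x zero ∷ b , independent-∷ ind x₀∉ ,
      (λ { zero → zero , refl ; (suc i) → suc (proj₁ (b⊆x i)) , proj₂ (b⊆x i) }) ,
      λ { zero → ∈-span (x zero ∷ b) zero ; (suc j) → span-∷ (x zero) {b} (x⊆b j) }

  opaque
    span-hasDim : ∀ {N} (x : Fin N → V) → ∃ λ d → HasDim (InSpan x) d
    span-hasDim x with basisOfSpan x
    ... | d , b , ind , b⊆x , x⊆b = d , b , b∈ , ind ,
      (λ y → span-trans {a = x} {b} x⊆b) , (λ y → span-trans {a = b} {x} b∈)
      where
      b∈ : ∀ i → InSpan x (b i)
      b∈ i = subst (InSpan x) (sym (proj₂ (b⊆x i))) (∈-span x (proj₁ (b⊆x i)))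

  opaque
    -- As soon as one vector lies in the span of the later ones, a generator is saved. Over L and
    -- with h+1 vectors, the second case leaves at most h generators.
    independent⊎spannedByFewer : ∀ {N} (x : Fin N → V) →
      Independent x ⊎ (∃ λ M → M < N × Σ (Fin M → V) λ y → ∀ i → InSpan y (x i))
    independent⊎spannedByFewer {zero} x = inj₁ λ c _ _ ()
    independent⊎spannedByFewer {suc N} x with independent⊎spannedByFewer (x ∘ suc)
    ... | inj₂ (M , M<N , y , x⊆y) = inj₂ (suc M , s≤s M<N , x zero ∷ y ,
      λ { zero → ∈-span (x zero ∷ y) zero ; (suc i) → span-∷ (x zero) {y} (x⊆y i) })
    ... | inj₁ ind with inSpan? (x ∘ suc) (x zero)
    ... | yes x₀∈ = inj₂ (N , ℕ.≤-refl , x ∘ suc , λ { zero → x₀∈ ; (suc i) → ∈-span (x ∘ suc) i })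
    ... | no x₀∉ = inj₁ λ c Sc eq → independent-∷ ind x₀∉ c Sc eq

  opaque
    -- While the family has fewer than `e` vectors, some `a j` lies outside its span and can be
    -- added; the induction on `≤′` adds one at a time. Started from the empty family, it yields an
    -- independent family in `P` of any size up to `e`.
    extend : ∀ {P : V → Set} {d e t} {b : Fin d → V} {a : Fin e → V} → Independent b → Independent a →
      (∀ i → P (b i)) → (∀ i → P (a i)) → d ≤′ t → t ≤ e →
      Σ (Fin t → V) λ b′ → Independent b′ × (∀ i → P (b′ i)) × (∀ i → InSpan b′ (b i))
    extend {b = b} b-ind a-ind Pb Pa ≤′-refl t≤e = b , b-ind , Pb , ∈-span b
    extend {P} {e = e} {a = a} b-ind a-ind Pb Pa (≤′-step d≤t) t<e
      with extend {P} b-ind a-ind Pb Pa d≤t (ℕ.<⇒≤ t<e)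
    ... | b′ , b′-ind , Pb′ , b⊆b′ with
      Fin.¬∀⟶∃¬ e (λ j → InSpan b′ (a j)) (λ j → inSpan? b′ (a j))
        (λ a⊆b′ → dependent {a = b′} {a} t<e a⊆b′ a-ind)
    ... | j , aⱼ∉ = a j ∷ b′ , independent-∷ b′-ind aⱼ∉ ,
      (λ { zero → Pa j ; (suc i) → Pb′ i }) , λ i → span-∷ (a j) {b′} (b⊆b′ i)

  masked : ∀ {A : Set} → V → Dec A → V
  masked x (yes _) = x
  masked x (no _) = 0v

  opaque
    -- The basis is selected from an enumeration of V, with the vectors outside P masked by 0.
    subspace-hasDim : ∀ {N} (v : Fin N → V) → (∀ x → ∃ λ i → v i ≈ x) →
      ∀ {P} → IsSubspace P → (∀ x → Dec (P x)) → ∃ λ d → HasDim P d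
    subspace-hasDim {N} v v-onto {P} sub P? with span-hasDim (λ i → masked (v i) (P? (v i)))
    ... | d , b , b∈ , ind , span⊆b , b⊆span = d , b ,
      (λ i → span⊆P (b i) (b∈ i)) , ind , (λ x Px → span⊆b x (P⊆span x Px)) , (λ x x∈b → span⊆P x (b⊆span x x∈b))
      where
      w : Fin N → V
      w i = masked (v i) (P? (v i))
      P-masked : ∀ {x} (Px? : Dec (P x)) → P (masked x Px?)
      P-masked (yes p) = p
      P-masked (no _) = P-0 sub
      masked-P : ∀ {x} (Px? : Dec (P x)) → P x → masked x Px? ≡ x
      masked-P (yes _) p = refl
      masked-P (no ¬p) p = contradiction p ¬p
      span⊆P : ∀ x → InSpan w x → P x
      span⊆P = span-⊆ sub (λ i → P-masked (P? (v i)))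
      P⊆span : ∀ x → P x → InSpan w x
      P⊆span x Px with v-onto x
      ... | i , vᵢ≈x = resp (span-isSubspace w) vᵢ≈x
        (subst (InSpan w) (masked-P (P? (v i)) (resp sub (≈ᴹ-sym vᵢ≈x) Px)) (∈-span w i))

-- The extension L / K and the kernel of a matrix

module FiniteFieldExt (F : FieldExt) (q m : ℕ) (K-enum : Fin q ↔ Σ (L F) (K F)) (L-enum : Fin (q ^ m) ↔ L F) where
  open FieldExt F using (0#; 1#; -_) renaming (_+_ to _⊞_; _*_ to _⊠_)
  private module R = CommutativeRing (commutativeRing F)

  opaque
    _≟_ : DecidableEquality (L F)
    _≟_ = inj⇒≟ (Inverse⇒Injection (↔-sym L-enum))

  subfieldK : FiniteSubfield F
  subfieldK = record
    { S = K F ; S-irrelevant = FieldExt.K-prop F ; S-0 = FieldExt.K-0 F ; S-1 = FieldExt.K-1 F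
    ; S-+ = FieldExt.K-+ F ; S-* = FieldExt.K-* F ; S-neg = FieldExt.K-neg F ; S-inv = FieldExt.K-inv F
    ; size = q ; enum = K-enum }

  subfieldL : FiniteSubfield F
  subfieldL = record
    { S = λ _ → ⊤ ; S-irrelevant = λ _ _ → refl ; S-0 = tt ; S-1 = tt
    ; S-+ = λ _ _ → tt ; S-* = λ _ _ → tt ; S-neg = λ _ → tt ; S-inv = λ _ _ → tt
    ; size = q ^ m
    ; enum = mk↔ₛ′ (λ i → Inverse.to L-enum i , tt) (λ x → Inverse.from L-enum (proj₁ x))
        (λ x → cong (_, tt) (Inverse.strictlyInverseˡ L-enum (proj₁ x)))
        (Inverse.strictlyInverseʳ L-enum) }

  Vect-isLeftSemimodule : ∀ k → IsLeftSemimodule (semiring F) (_≈v_ F {k}) (_⊕v_ F) (0v F) (_·v_ F)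
  Vect-isLeftSemimodule k = record
    { +ᴹ-isCommutativeMonoid = record
      { isMonoid = record
        { isSemigroup = record
          { isMagma = record
            { isEquivalence = record
              { refl = λ _ → refl ; sym = λ e i → sym (e i) ; trans = λ e e′ i → trans (e i) (e′ i) }
            ; ∙-cong = λ e e′ i → cong₂ _⊞_ (e i) (e′ i) }
          ; assoc = λ x y z i → R.+-assoc (x i) (y i) (z i) }
        ; identity = (λ x i → R.+-identityˡ (x i)) , (λ x i → R.+-identityʳ (x i)) }
      ; comm = λ x y i → R.+-comm (x i) (y i) }
    ; isPreleftSemimodule = record
      { *ₗ-cong = λ e e′ i → cong₂ _⊠_ e (e′ i)
      ; *ₗ-zeroˡ = λ x i → R.zeroˡ (x i)
      ; *ₗ-distribʳ = λ x a b i → R.distribʳ (x i) a b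
      ; *ₗ-identityˡ = λ x i → R.*-identityˡ (x i)
      ; *ₗ-assoc = λ a b x i → R.*-assoc a b (x i)
      ; *ₗ-zeroʳ = λ a i → R.zeroʳ a
      ; *ₗ-distribˡ = λ a x y i → R.distribˡ a (x i) (y i) } }

  _≟v_ : ∀ {k} → Decidable (_≈v_ F {k})
  x ≟v y = all? (λ i → x i ≟ y i)

  -- `KL` is L over K, where rank weights live; `KV` is the vector space over K that contains `U`;
  -- `LV` is the same space over L, with the subspaces `W` and the codes.
  module KL = LinearAlgebra F _≟_ subfieldK (L F) _≡_ _≟_ 0# _⊞_ _⊠_
    (LeftSemimodule.isLeftSemimodule (leftSemimodule {R = semiring F}))
  module KV (k : ℕ) = LinearAlgebra F _≟_ subfieldK (Vect F k) (_≈v_ F) _≟v_ (0v F) (_⊕v_ F) (_·v_ F) (Vect-isLeftSemimodule k)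
  module LV (k : ℕ) = LinearAlgebra F _≟_ subfieldL (Vect F k) (_≈v_ F) _≟v_ (0v F) (_⊕v_ F) (_·v_ F) (Vect-isLeftSemimodule k)

  -- Sums, matrices and the change of scalars

  ∑-cong : ∀ {d} {f g : Fin d → L F} → f ≗ g → ∑ F f ≡ ∑ F g
  ∑-cong {zero} f≗g = refl
  ∑-cong {suc d} f≗g = cong₂ _⊞_ (f≗g zero) (∑-cong (f≗g ∘ suc))

  ∑-*-comm : ∀ {d} (f g : Fin d → L F) → ∑ F (λ i → f i ⊠ g i) ≡ ∑ F (λ i → g i ⊠ f i)
  ∑-*-comm f g = ∑-cong (λ i → R.*-comm (f i) (g i))

  KL-lincomb : ∀ {d} (c b : Fin d → L F) → KL.lincomb c b ≡ ∑ F (λ i → c i ⊠ b i)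
  KL-lincomb {zero} c b = refl
  KL-lincomb {suc d} c b = cong (c zero ⊠ b zero ⊞_) (KL-lincomb (c ∘ suc) (b ∘ suc))

  LV-lincomb : ∀ {k d} (c : Fin d → L F) (b : Fin d → Vect F k) i → LV.lincomb k c b i ≡ ∑ F (λ j → c j ⊠ b j i)
  LV-lincomb {d = zero} c b i = refl
  LV-lincomb {d = suc d} c b i = cong (c zero ⊠ b zero i ⊞_) (LV-lincomb (c ∘ suc) (b ∘ suc) i)

  -- The two instances define combinations separately, by the same recursion. The equality lets
  -- K-linear expansions enter L-linear relations.
  KV≡LV : ∀ {k d} (c : Fin d → L F) (b : Fin d → Vect F k) → KV.lincomb k c b ≡ LV.lincomb k c b
  KV≡LV {d = zero} c b = refl
  KV≡LV {k} {suc d} c b = cong (_⊕v_ F (_·v_ F (c zero) (b zero))) (KV≡LV (c ∘ suc) (b ∘ suc))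

  δ-sym : ∀ {d} (i j : Fin d) → δ F i j ≡ δ F j i
  δ-sym i j with i Fin.≟ j | j Fin.≟ i
  ... | yes _ | yes _ = refl
  ... | yes i≡j | no j≢i = contradiction (sym i≡j) j≢i
  ... | no i≢j | yes j≡i = contradiction (sym j≡i) i≢j
  ... | no _ | no _ = refl

  ∑-δ : ∀ {d} (f : Fin d → L F) i → ∑ F (λ j → f j ⊠ δ F j i) ≡ f i
  ∑-δ f i = trans (∑-*-comm f (λ j → δ F j i))
    (trans (∑-cong (λ j → cong (_⊠ f j) (δ-sym j i)))
      (trans (sym (KL-lincomb (δ F i) f)) (KL.lincomb-δ i f)))

  -- c = (NM)c = N(Mc) = 0. This is the way full rank of a matrix is used: the matrix comes with a
  -- left inverse.
  left-inverse-injective : ∀ {d e} (N : Fin d → Fin e → L F) (M : Fin e → Fin d → L F) →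
    (∀ i j → ∑ F (λ l → N i l ⊠ M l j) ≡ δ F i j) →
    ∀ (c : Fin d → L F) → (∀ l → ∑ F (λ j → c j ⊠ M l j) ≡ 0#) → ∀ i → c i ≡ 0#
  left-inverse-injective N M NM≡δ c Mc≡0 i = begin
    c i                                              ≡⟨ KL.lincomb-δ i c ⟨
    KL.lincomb (δ F i) c                             ≡⟨ KL.lincomb-cong (NM≡δ i) (λ _ → refl) ⟨
    KL.lincomb (λ j → ∑ F (λ l → N i l ⊠ M l j)) c   ≡⟨ KL.lincomb-lincomb (N i) M c ⟨
    KL.lincomb (N i) (λ l → KL.lincomb (M l) c)      ≡⟨ KL.lincomb-zeroʳ (N i) Mlc≡0 ⟩
    0#                                               ∎
    where
    open ≡-Reasoning
    Mlc≡0 : ∀ l → KL.lincomb (M l) c ≡ 0#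
    Mlc≡0 l = trans (KL-lincomb (M l) c) (trans (∑-*-comm (M l) c) (Mc≡0 l))

  nonZero : ∀ {n} (z : Vect F n) → ¬ (∀ i → z i ≡ 0#) → NonZero F z
  nonZero {n} z z≢0 = Fin.¬∀⟶∃¬ n _ (λ i → z i ≟ 0#) z≢0

  -- The degree of L over K, and rank weights

  opaque
    basis-L : ∃ λ e → Σ (Fin e → L F) λ β → KL.Independent β × (∀ x → KL.InSpan β x)
    basis-L with KL.basisOfSpan (Inverse.to L-enum)
    ... | e , β , ind , _ , L⊆β = e , β , ind , λ x →
      subst (KL.InSpan β) (Inverse.strictlyInverseˡ L-enum x) (L⊆β (Inverse.from L-enum x))

  -- The degree `m` is given as the exponent in the cardinality of L: coordinates over `β` inject
  -- `q ^ m` elements into `q ^ e` codes.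
  m≤spanning : ∀ {e} {β : Fin e → L F} → (∀ x → KL.InSpan β x) → m ≤ e
  m≤spanning {e} {β} expand = ℕ.≮⇒≥ λ e<m → absurd (pigeonhole (ℕ.^-monoʳ-< q KL.1<size e<m) encode)
    where
    x : (i : Fin (q ^ m)) → KL.InSpan β (Inverse.to L-enum i)
    x i = expand (Inverse.to L-enum i)
    encode : Fin (q ^ m) → Fin (q ^ e)
    encode i = KL.code (proj₁ (x i)) (proj₁ (proj₂ (x i)))
    decode : ∀ i → KL.lincomb (KL.coefficients e (encode i)) β ≡ Inverse.to L-enum i
    decode i = trans (KL.lincomb-cong (KL.coefficients-code (proj₁ (x i)) (proj₁ (proj₂ (x i)))) (λ _ → refl))
      (proj₂ (proj₂ (x i)))
    absurd : ¬ (∃ λ i → ∃ λ j → i Fin.< j × encode i ≡ encode j)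
    absurd (i , j , i<j , eq) = Fin.<⇒≢ i<j (trans (sym (Inverse.strictlyInverseʳ L-enum i))
      (trans (cong (Inverse.from L-enum) (trans (sym (decode i))
        (trans (cong (λ c → KL.lincomb (KL.coefficients e c) β) eq) (decode j))))
        (Inverse.strictlyInverseʳ L-enum j)))

  opaque
    -- A K-basis of L has at least `m` elements. With t = h+2 this supplies the entries of a
    -- codeword of least weight.
    independent-L : ∀ {t} → t ≤ m → Σ (Fin t → L F) KL.Independent
    independent-L t≤m with basis-L
    ... | e , β , ind , L⊆β with KL.extend {P = λ _ → ⊤} {b = []} KL.independent-[] ind (λ ()) (λ _ → tt)
      (ℕ.≤⇒≤′ z≤n) (ℕ.≤-trans t≤m (m≤spanning {β = β} L⊆β))
    ... | u , u-ind , _ = u , u-ind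

  -- A vector of length `k` is also a coefficient vector over L, so the numbering of the latter is
  -- reused.
  Vect-enum : ∀ k → Fin ((q ^ m) ^ k) → Vect F k
  Vect-enum k = LV.coefficients k k

  Vect-enum-onto : ∀ k (x : Vect F k) → ∃ λ i → _≈v_ F (Vect-enum k i) x
  Vect-enum-onto k x = LV.code k x (λ _ → tt) , LV.coefficients-code k x (λ _ → tt)

  standard-independent : ∀ n → LV.Independent n (δ F)
  standard-independent n c _ eq i = trans (sym (∑-δ c i)) (trans (sym (LV-lincomb c (δ F) i)) (eq i))

  standard-spans : ∀ {n} (x : Vect F n) → LV.InSpan n (δ F) x
  standard-spans x = x , (λ _ → tt) , λ i → trans (LV-lincomb x (δ F) i) (∑-δ x i)

  K-span⊆L-span : ∀ {k d} {b : Fin d → Vect F k} {x} → KV.InSpan k b x → LV.InSpan k b x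
  K-span⊆L-span {k} {b = b} {x} (c , _ , eq) = c , (λ _ → tt) , subst (λ y → _≈v_ F y x) (KV≡LV c b) eq

  rankWeight-exists : ∀ {n} (z : Vect F n) → ∃ (RankWeight F z)
  rankWeight-exists = KL.span-hasDim

  rankWeight-≤ : ∀ {n t w} {z : Vect F n} {u : Fin t → L F} → (∀ l → KL.InSpan u (z l)) → RankWeight F z w → w ≤ t
  rankWeight-≤ {z = z} {u} z⊆u (b , b∈ , b-ind , _) =
    KL.steinitz {a = u} {b} b-ind (λ i → KL.span-trans {a = z} {u} z⊆u (b∈ i))

  rankWeight-positive : ∀ {n w} {z : Vect F n} → NonZero F z → RankWeight F z w → 0 < w
  rankWeight-positive {w = suc w} _ _ = s≤s z≤n
  -- An entry in the span of no vectors equals the empty combination, which is `0#`.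
  rankWeight-positive {w = zero} {z} (i , zᵢ≢0) (_ , _ , _ , z⊆b , _) =
    contradiction (sym (proj₂ (proj₂ (z⊆b (z i) (KL.∈-span z i))))) zᵢ≢0

  -- Light kernel words and dependent vectors of U

  module KernelCode {k n : ℕ} {U : Vect F k → Set} (g : Fin n → Vect F k) (g-basis : KV.IsBasis k U g) where
    private
      module ≈k = IsLeftSemimodule (Vect-isLeftSemimodule k)
      module ≈-Reasoning = SetoidReasoning ≈k.≈ᴹ-setoid
      _≈_ = _≈v_ F {k}
      g∈U = proj₁ g-basis
      g-independent = proj₁ (proj₂ g-basis)
      U⊆span = proj₁ (proj₂ (proj₂ g-basis))

    Kernel : Vect F n → Set
    Kernel z = LV.lincomb k z g ≈ 0v F

    -- z = M u for a K-basis u of the span of its entries, and X = g M.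
    light⇒dependent : ∀ {z w} → Kernel z → RankWeight F z w →
      Σ (Fin w → Vect F k) λ X → (∀ j → U (X j)) × KV.Independent k X ×
      Σ (Fin w → L F) λ u → KL.Independent u × LV.lincomb k u X ≈ 0v F
    light⇒dependent {z} {w} gz≈0 (u , u∈ , u-ind , z⊆u , _) = X , X∈U , X-ind , u , u-ind , uX≈0
      where
      N : Fin w → Fin n → L F
      N i = proj₁ (u∈ i)
      M : Fin n → Fin w → L F
      M l = proj₁ (z⊆u (z l) (KL.∈-span z l))
      K-M : ∀ l j → K F (M l j)
      K-M l = proj₁ (proj₂ (z⊆u (z l) (KL.∈-span z l)))
      Mu≡z : ∀ l → KL.lincomb (M l) u ≡ z l
      Mu≡z l = proj₂ (proj₂ (z⊆u (z l) (KL.∈-span z l)))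
      -- Nz = u and Mu = z give (NM)u = u, and K-coordinates over `u` are unique. So `N` is a left
      -- inverse of `M`, which therefore has rank `w`.
      NM≡δ : ∀ i j → ∑ F (λ l → N i l ⊠ M l j) ≡ δ F i j
      NM≡δ i = KL.independent-unique u-ind
        (λ j → FiniteSubfield.S-∑ subfieldK (λ l → FieldExt.K-* F (proj₁ (proj₂ (u∈ i)) l) (K-M l j)))
        (FiniteSubfield.S-δ subfieldK i)
        (begin
          KL.lincomb (λ j → ∑ F (λ l → N i l ⊠ M l j)) u   ≡⟨ KL.lincomb-lincomb (N i) M u ⟨
          KL.lincomb (N i) (λ l → KL.lincomb (M l) u)      ≡⟨ KL.lincomb-cong (λ _ → refl) Mu≡z ⟩
          KL.lincomb (N i) z                               ≡⟨ proj₂ (proj₂ (u∈ i)) ⟩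
          u i                                              ≡⟨ KL.lincomb-δ i u ⟨
          KL.lincomb (δ F i) u                             ∎)
        where open ≡-Reasoning
      X : Fin w → Vect F k
      X j = KV.lincomb k (λ l → M l j) g
      X∈U : ∀ j → U (X j)
      X∈U j = KV.lincomb-closed k (KV.basis-isSubspace k g-basis) (λ l → K-M l j) g∈U
      -- A K-relation `c` on `X` makes Mc a relation on `g`; hence Mc = 0, and `N` cancels `M`.
      X-ind : KV.Independent k X
      X-ind c Kc cX≈0 = left-inverse-injective N M NM≡δ c
        (g-independent _ (λ l → FiniteSubfield.S-∑ subfieldK (λ j → FieldExt.K-* F (Kc j) (K-M l j)))
          (≈k.≈ᴹ-trans (≈k.≈ᴹ-sym (KV.lincomb-lincomb k c (λ j l → M l j) g)) cX≈0))
      uX≈0 : LV.lincomb k u X ≈ 0v F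
      uX≈0 = begin
        LV.lincomb k u X                                       ≈⟨ LV.lincomb-cong k (λ _ → refl) (λ j → ≈k.≈ᴹ-reflexive (KV≡LV (λ l → M l j) g)) ⟩
        LV.lincomb k u (λ j → LV.lincomb k (λ l → M l j) g)    ≈⟨ LV.lincomb-lincomb k u (λ j l → M l j) g ⟩
        LV.lincomb k (λ l → ∑ F (λ j → u j ⊠ M l j)) g         ≈⟨ LV.lincomb-cong k (λ l → trans (∑-*-comm u (M l)) (trans (sym (KL-lincomb (M l) u)) (Mu≡z l))) (λ _ → ≈k.≈ᴹ-refl) ⟩
        LV.lincomb k z g                                       ≈⟨ gz≈0 ⟩
        0v F                                                   ∎
        where open ≈-Reasoning

    -- Inverts the factorisation: expand each `X j` over `g` with coefficients `M j` in K and
    -- combine these rows with the weights `u`. The entries of the resulting word lie in the K-span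
    -- of `u`, so its rank weight is at most `t`.
    dependent⇒light : ∀ {t} (X : Fin t → Vect F k) → (∀ j → U (X j)) → KV.Independent k X →
      (u : Fin t → L F) → NonZero F u → LV.lincomb k u X ≈ 0v F →
      Σ (Vect F n) λ z → NonZero F z × Kernel z × ∀ l → KL.InSpan u (z l)
    dependent⇒light {t} X X∈U X-ind u (j₀ , uⱼ≢0) uX≈0 = z , nonZero z z≢0 , gz≈0 , z∈
      where
      M : Fin t → Fin n → L F
      M j = proj₁ (U⊆span (X j) (X∈U j))
      Mg≈X : ∀ j → KV.lincomb k (M j) g ≈ X j
      Mg≈X j = proj₂ (proj₂ (U⊆span (X j) (X∈U j)))
      z : Vect F n
      z l = ∑ F (λ j → u j ⊠ M j l)
      Mu≡z : ∀ l → KL.lincomb (λ j → M j l) u ≡ z l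
      Mu≡z l = trans (KL-lincomb (λ j → M j l) u) (∑-*-comm (λ j → M j l) u)
      z∈ : ∀ l → KL.InSpan u (z l)
      z∈ l = (λ j → M j l) , (λ j → proj₁ (proj₂ (U⊆span (X j) (X∈U j))) l) , Mu≡z l
      gz≈0 : Kernel z
      gz≈0 = begin
        LV.lincomb k z g                               ≈⟨ LV.lincomb-lincomb k u M g ⟨
        LV.lincomb k u (λ j → LV.lincomb k (M j) g)    ≈⟨ LV.lincomb-cong k (λ _ → refl) (λ j → ≈k.≈ᴹ-trans (≈k.≈ᴹ-reflexive (sym (KV≡LV (M j) g))) (Mg≈X j)) ⟩
        LV.lincomb k u X                               ≈⟨ uX≈0 ⟩
        0v F                                           ∎
        where open ≈-Reasoning
      -- Expanding u in a K-basis of L turns z = 0 into K-linear relations between the vectors X.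
      z≢0 : ¬ (∀ l → z l ≡ 0#)
      z≢0 z≡0 with basis-L
      ... | e , β , β-ind , L⊆β = uⱼ≢0 (begin
        u j₀                          ≡⟨ aβ≡u j₀ ⟨
        KL.lincomb (a j₀) β           ≡⟨ KL.lincomb-zeroˡ β (λ p → a≡0 p j₀) ⟩
        0#                            ∎)
        where
        open ≡-Reasoning
        a : Fin t → Fin e → L F
        a j = proj₁ (L⊆β (u j))
        K-a : ∀ j p → K F (a j p)
        K-a j = proj₁ (proj₂ (L⊆β (u j)))
        aβ≡u : ∀ j → KL.lincomb (a j) β ≡ u j
        aβ≡u j = proj₂ (proj₂ (L⊆β (u j)))
        Ma≡0 : ∀ l p → ∑ F (λ j → M j l ⊠ a j p) ≡ 0#
        Ma≡0 l = β-ind _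
          (λ p → FiniteSubfield.S-∑ subfieldK (λ j → FieldExt.K-* F (proj₁ (proj₂ (z∈ l)) j) (K-a j p)))
          (begin
            KL.lincomb (λ p → ∑ F (λ j → M j l ⊠ a j p)) β          ≡⟨ KL.lincomb-lincomb (λ j → M j l) a β ⟨
            KL.lincomb (λ j → M j l) (λ j → KL.lincomb (a j) β)     ≡⟨ KL.lincomb-cong (λ _ → refl) aβ≡u ⟩
            KL.lincomb (λ j → M j l) u                              ≡⟨ Mu≡z l ⟩
            z l                                                     ≡⟨ z≡0 l ⟩
            0#                                                      ∎)
        a≡0 : ∀ p j → a j p ≡ 0#
        a≡0 p = X-ind (λ j → a j p) (λ j → K-a j p)
          (≈k.≈ᴹ-trans (KV.lincomb-cong k (λ _ → refl) (λ j → ≈k.≈ᴹ-sym (Mg≈X j)))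
            (≈k.≈ᴹ-trans (KV.lincomb-lincomb k (λ j → a j p) M g)
              (KV.lincomb-zeroˡ k g (λ l → trans (∑-*-comm (λ j → a j p) (λ j → M j l)) (Ma≡0 l p)))))

    -- If U ∩ W had dimension above `h`, then h+1 of its K-independent vectors would be L-dependent
    -- inside `W`, and the relation would give a nonzero kernel word of weight at most h+1.
    heavy⇒scattered : ∀ {h} → (∀ {z w} → NonZero F z → Kernel z → RankWeight F z w → 2 + h ≤ w) → HScattered F k h U
    heavy⇒scattered {h} heavy W (b , _ , _ , W⊆b , _) d (c , c∈ , c-ind , _) = ℕ.≮⇒≥ light
      where
      light : ¬ (h < d)
      light h<d with KV.extend k {P = λ x → U x × W x} {b = []} (KV.independent-[] k) c-ind (λ ()) c∈ (ℕ.≤⇒≤′ z≤n) h<d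
      ... | X , X-ind , X∈ , _ with LV.dependence k {a = b} {X} ℕ.≤-refl (λ j → W⊆b (X j) (proj₂ (X∈ j)))
      ... | u , _ , uX≈0 , u≢0 with dependent⇒light X (proj₁ ∘ X∈) X-ind u u≢0 uX≈0
      ... | z , z≢0 , gz≈0 , z∈ with rankWeight-exists z
      ... | w , rw = ℕ.<⇒≱ (heavy z≢0 gz≈0 rw) (rankWeight-≤ {u = u} z∈ rw)

    -- A nonzero kernel word of weight at most h+1 gives K-independent vectors of `U` with an
    -- L-relation. They are enlarged to exactly h+1 vectors, which then turn out to lie in an
    -- h-dimensional L-subspace.
    scattered⇒heavy : ∀ {h} → h < k → h < n → HScattered F k h U →
      ∀ {z w} → NonZero F z → Kernel z → RankWeight F z w → 2 + h ≤ w
    scattered⇒heavy {h} h<k h<n scattered {z} {w} z≢0 gz≈0 rw = ℕ.≮⇒≥ λ w<2+h → light (ℕ.≤-pred w<2+h)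
      where
      light : ¬ (w ≤ suc h)
      light w≤1+h with light⇒dependent gz≈0 rw
      ... | X , X∈U , X-ind , u , u-ind , uX≈0
        -- Padding with columns of `g` is possible because h+1 does not exceed `n`.
        with KV.extend k {P = U} X-ind g-independent X∈U g∈U (ℕ.≤⇒≤′ w≤1+h) h<n
      ... | X′ , X′-ind , X′∈U , X⊆X′ with LV.independent⊎spannedByFewer k X′
      -- Write X = NX′ with `N` over K. The relation `u` on `X` becomes uN = 0, and since `u` is
      -- K-independent, `N` vanishes; so does `X`, which is nonempty and independent.
      ... | inj₁ X′-L-ind = KV.independent⇒≉0 k X-ind j₀ (≈k.≈ᴹ-trans (≈k.≈ᴹ-sym (proj₂ (proj₂ (X⊆X′ j₀))))
          (KV.lincomb-zeroˡ k X′ (λ i → N≡0 i j₀)))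
        where
        j₀ : Fin w
        j₀ = Fin.fromℕ< (rankWeight-positive z≢0 rw)
        N : Fin w → Fin (suc h) → L F
        N j = proj₁ (X⊆X′ j)
        uN≡0 : ∀ i → ∑ F (λ j → u j ⊠ N j i) ≡ 0#
        uN≡0 = X′-L-ind _ (λ _ → tt) (begin
          LV.lincomb k (λ i → ∑ F (λ j → u j ⊠ N j i)) X′   ≈⟨ LV.lincomb-lincomb k u N X′ ⟨
          LV.lincomb k u (λ j → LV.lincomb k (N j) X′)      ≈⟨ LV.lincomb-cong k (λ _ → refl) (λ j → ≈k.≈ᴹ-trans (≈k.≈ᴹ-reflexive (sym (KV≡LV (N j) X′))) (proj₂ (proj₂ (X⊆X′ j)))) ⟩
          LV.lincomb k u X                                  ≈⟨ uX≈0 ⟩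
          0v F                                              ∎)
          where open ≈-Reasoning
        N≡0 : ∀ i j → N j i ≡ 0#
        N≡0 i = u-ind (λ j → N j i) (λ j → proj₁ (proj₂ (X⊆X′ j)) i)
          (trans (KL-lincomb (λ j → N j i) u) (trans (∑-*-comm (λ j → N j i) u) (uN≡0 i)))
      ... | inj₂ (M , M<1+h , Y , X′⊆Y) with LV.basisOfSpan k Y
      ... | r , b , b-ind , b⊆Y , Y⊆b
        -- Scatteredness speaks of dimension exactly `h`, so the span of at most `h` vectors is
        -- enlarged to it, which `h < k` permits.
        with LV.extend k {P = λ _ → ⊤} b-ind (standard-independent k) (λ _ → tt) (λ _ → tt)
          (ℕ.≤⇒≤′ (ℕ.≤-trans r≤M (ℕ.≤-pred M<1+h))) (ℕ.<⇒≤ h<k)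
        where
        r≤M : r ≤ M
        r≤M = LV.steinitz k {a = Y} {b} b-ind
          (λ i → subst (LV.InSpan k Y) (sym (proj₂ (b⊆Y i))) (LV.∈-span k Y (proj₁ (b⊆Y i))))
      ... | b′ , b′-ind , _ , b⊆b′
        -- The bound of scatteredness applies once U ∩ W has a dimension; decidable membership
        -- provides one.
        with KV.subspace-hasDim k (Vect-enum k) (Vect-enum-onto k) U∩W-isSubspace
          (λ x → U? x ×-dec LV.inSpan? k b′ x)
        where
        U? : ∀ x → Dec (U x)
        U? x = map′ (proj₂ (proj₂ (proj₂ g-basis)) x) (U⊆span x) (KV.inSpan? k g x)
        W-isSubspace : KV.IsSubspace k (LV.InSpan k b′)
        W-isSubspace = record
          { resp = LV.resp {k} sp ; P-0 = LV.P-0 {k} sp ; P-⊕ = LV.P-⊕ {k} sp ; P-· = λ _ → LV.P-· {k} sp tt }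
          where sp = LV.span-isSubspace k b′
        U∩W-isSubspace : KV.IsSubspace k (λ x → U x × LV.InSpan k b′ x)
        U∩W-isSubspace = KV.∩-isSubspace k (KV.basis-isSubspace k g-basis) W-isSubspace
      ... | d , c , c-basis = ℕ.<⇒≱ h<d
        (scattered (LV.InSpan k b′) (b′ , LV.independent⇒spanBasis k b′-ind) d (c , c-basis))
        where
        X′∈W : ∀ i → LV.InSpan k b′ (X′ i)
        X′∈W i = LV.span-trans k {a = b} {b′} b⊆b′ (LV.span-trans k {a = Y} {b} Y⊆b (X′⊆Y i))
        h<d : h < d
        h<d = KV.steinitz k {a = c} {X′} X′-ind
          (λ i → proj₁ (proj₂ (proj₂ c-basis)) (X′ i) (X′∈U i , X′∈W i))

    -- Singleton bound and dimension of the kernel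

    Kernel-isSubspace : LV.IsSubspace n Kernel
    Kernel-isSubspace = record
      { resp = λ x≈y gx≈0 → ≈k.≈ᴹ-trans (LV.lincomb-cong k (λ l → sym (x≈y l)) (λ _ → ≈k.≈ᴹ-refl)) gx≈0
      ; P-0 = LV.lincomb-zeroˡ k g (λ _ → refl)
      ; P-⊕ = λ {x} {y} gx≈0 gy≈0 → ≈k.≈ᴹ-trans (LV.lincomb-+ k x y g)
          (≈k.≈ᴹ-trans (≈k.+ᴹ-cong gx≈0 gy≈0) (≈k.+ᴹ-identityˡ (0v F)))
      ; P-· = λ {a} {x} _ gx≈0 → ≈k.≈ᴹ-trans (LV.lincomb-* k a x g)
          (≈k.≈ᴹ-trans (≈k.*ₗ-congˡ gx≈0) (≈k.*ₗ-zeroʳ a)) }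

    -- The Singleton bound: the vectors with entries in the span of u outnumber their syndromes.
    codeword-in-span : ∀ {t} (u : Fin t → L F) → KL.Independent u → k * m < n * t →
      Σ (Vect F n) λ z → NonZero F z × Kernel z × ∀ l → KL.InSpan u (z l)
    codeword-in-span {t} u u-ind km<nt = conclude (KL.collision {n * t} fewer syndrome)
      where
      fewer : (q ^ m) ^ k < q ^ (n * t)
      fewer = subst (_< q ^ (n * t)) (sym (ℕ.^-*-assoc q m k))
        (ℕ.^-monoʳ-< q KL.1<size (subst (_< n * t) (ℕ.*-comm k m) km<nt))
      -- A single index of n·t digits is read as an n × t matrix over K.
      M : Fin (q ^ (n * t)) → Fin n → Fin t → L F
      M i l j = KL.coefficients (n * t) i (Fin.combine l j)
      K-M : ∀ i l j → K F (M i l j)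
      K-M i l j = KL.S-coefficients (n * t) i (Fin.combine l j)
      y : Fin (q ^ (n * t)) → Vect F n
      y i l = KL.lincomb (M i l) u
      syndrome : Fin (q ^ (n * t)) → Fin ((q ^ m) ^ k)
      syndrome i = LV.code k (LV.lincomb k (y i) g) (λ _ → tt)
      decode : ∀ i → LV.coefficients k k (syndrome i) ≈ LV.lincomb k (y i) g
      decode i = LV.coefficients-code k (LV.lincomb k (y i) g) (λ _ → tt)
      conclude : (∃ λ i → ∃ λ j → syndrome i ≡ syndrome j ×
          ∃ λ p → KL.coefficients (n * t) i p ≢ KL.coefficients (n * t) j p) →
        Σ (Vect F n) λ z → NonZero F z × Kernel z × ∀ l → KL.InSpan u (z l)
      conclude (i , j , eq , p , differ) = z , nonZero z z≢0 , LV.lincomb-difference k (y i) (y j) g equal , z∈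
        where
        z : Vect F n
        z l = y i l ⊞ (- 1#) ⊠ y j l
        equal : LV.lincomb k (y i) g ≈ LV.lincomb k (y j) g
        equal = begin
          LV.lincomb k (y i) g              ≈⟨ decode i ⟨
          LV.coefficients k k (syndrome i)  ≡⟨ cong (LV.coefficients k k) eq ⟩
          LV.coefficients k k (syndrome j)  ≈⟨ decode j ⟩
          LV.lincomb k (y j) g              ∎
          where open ≈-Reasoning
        y∈ : ∀ i l → KL.InSpan u (y i l)
        y∈ i l = M i l , K-M i l , refl
        z∈ : ∀ l → KL.InSpan u (z l)
        z∈ l = KL.P-⊕ sp (y∈ i l) (KL.P-· sp (FieldExt.K-neg F (FieldExt.K-1 F)) (y∈ j l))
          where sp = KL.span-isSubspace u
        z≢0 : ¬ (∀ l → z l ≡ 0#)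
        -- If z vanished at the row `l` of the differing position, the two words would agree there,
        -- and so would their coordinates over the independent `u`.
        z≢0 z≡0 = differ (subst (λ p → KL.coefficients (n * t) i p ≡ KL.coefficients (n * t) j p)
          (Fin.combine-remQuot {n} t p)
          (KL.independent-unique u-ind (K-M i l) (K-M j l) (KL.difference≡0 (z≡0 l)) (proj₂ (Fin.remQuot {n} t p))))
          where
          l : Fin n
          l = proj₁ (Fin.remQuot {n} t p)

    -- A basis of the kernel and preimages of the standard basis of Lᵏ together form a basis of Lⁿ.
    kernel-hasDim : (∀ x → LV.InSpanSet k U x) → ∃ λ e → LV.HasDim n Kernel e × e + k ≡ n
    kernel-hasDim U-spans = conclude
      (LV.subspace-hasDim n (Vect-enum n) (Vect-enum-onto n) Kernel-isSubspace (λ z → LV.lincomb k z g ≟v 0v F))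
      where
      module ≈n = IsLeftSemimodule (Vect-isLeftSemimodule n)
      -- `U` spans over L and `g` spans `U` over K, so the syndrome map is surjective; `r` picks
      -- preimages and gives a linear section.
      onto : ∀ x → LV.InSpan k g x
      onto x with U-spans x
      ... | d , b , b∈U , x∈b = LV.span-trans k {a = b} {g} (λ i → K-span⊆L-span (U⊆span (b i) (b∈U i))) x∈b
      r : Fin k → Vect F n
      r i = proj₁ (onto (δ F i))
      gr≈δ : ∀ i → LV.lincomb k (r i) g ≈ δ F i
      gr≈δ i = proj₂ (proj₂ (onto (δ F i)))
      section : ∀ x → LV.lincomb k (LV.lincomb n x r) g ≈ x
      section x = begin
        LV.lincomb k (LV.lincomb n x r) g                         ≈⟨ LV.lincomb-cong k (LV-lincomb x r) (λ _ → ≈k.≈ᴹ-refl) ⟩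
        LV.lincomb k (λ l → ∑ F (λ j → x j ⊠ r j l)) g            ≈⟨ LV.lincomb-lincomb k x r g ⟨
        LV.lincomb k x (λ j → LV.lincomb k (r j) g)               ≈⟨ LV.lincomb-cong k (λ _ → refl) gr≈δ ⟩
        LV.lincomb k x (δ F)                                      ≈⟨ proj₂ (proj₂ (standard-spans x)) ⟩
        x                                                         ∎
        where open ≈-Reasoning
      conclude : (∃ λ e → LV.HasDim n Kernel e) → ∃ λ e → LV.HasDim n Kernel e × e + k ≡ n
      conclude (e , N , N∈ , N-ind , kernel⊆N , N⊆kernel) = e , (N , N∈ , N-ind , kernel⊆N , N⊆kernel) ,
        ℕ.≤-antisym (LV.steinitz n {a = δ F} {N ++ r} ind (λ i → standard-spans ((N ++ r) i)))
          (LV.steinitz n {a = N ++ r} {δ F} (standard-independent n) (λ i → spans (δ F i)))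
        where
        N∈span : ∀ i → LV.InSpan n (N ++ r) (N i)
        N∈span i = subst (LV.InSpan n (N ++ r)) (lookup-++ˡ N r i) (LV.∈-span n (N ++ r) (i ↑ˡ k))
        r∈span : ∀ i → LV.InSpan n (N ++ r) (r i)
        r∈span i = subst (LV.InSpan n (N ++ r)) (lookup-++ʳ N r i) (LV.∈-span n (N ++ r) (e ↑ʳ i))
        -- Split y into y - r(gy), which lies in the kernel, and r(gy).
        spans : ∀ y → LV.InSpan n (N ++ r) y
        spans y = LV.resp {n} sp y′+ry≈y (LV.P-⊕ {n} sp
          (LV.span-trans n {a = N} {N ++ r} N∈span (kernel⊆N y′ gy′≈0)) ry∈)
          where
          sp = LV.span-isSubspace n (N ++ r)
          ry : Vect F n
          ry = LV.lincomb n (LV.lincomb k y g) r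
          ry∈ : LV.InSpan n (N ++ r) ry
          ry∈ = LV.lincomb-closed n sp (λ _ → tt) r∈span
          y′ : Vect F n
          y′ l = y l ⊞ (- 1#) ⊠ ry l
          gy′≈0 : Kernel y′
          gy′≈0 = LV.lincomb-difference k y ry g (≈k.≈ᴹ-sym (section (LV.lincomb k y g)))
          y′+ry≈y : _≈v_ F (_⊕v_ F y′ ry) y
          y′+ry≈y = ≈n.≈ᴹ-trans (≈n.+ᴹ-assoc y _ ry)
            (≈n.≈ᴹ-trans (≈n.+ᴹ-congˡ {y} (≈n.≈ᴹ-trans (≈n.+ᴹ-comm _ ry) (LV.⊕-inverseʳ n ry))) (≈n.+ᴹ-identityʳ y))
        ind : LV.Independent n (N ++ r)
        ind c _ c≈0 i = subst (λ i → c i ≡ 0#) (Fin.join-splitAt e k i) (vanish (Fin.splitAt e i))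
          where
          c₁ : Fin e → L F
          c₁ i = c (i ↑ˡ k)
          c₂ : Vect F k
          c₂ i = c (e ↑ʳ i)
          split≈0 : _≈v_ F (_⊕v_ F (LV.lincomb n c₁ N) (LV.lincomb n c₂ r)) (0v F)
          split≈0 = ≈n.≈ᴹ-trans (≈n.≈ᴹ-sym (LV.lincomb-++ n c N r)) c≈0
          -- Applying `g` to the relation kills the kernel part, and the section property leaves
          -- exactly `c₂`.
          c₂≈0 : c₂ ≈ 0v F
          c₂≈0 = begin
            c₂                                                      ≈⟨ section c₂ ⟨
            LV.lincomb k y₂ g                                       ≈⟨ ≈k.+ᴹ-identityˡ _ ⟨
            _⊕v_ F (0v F) (LV.lincomb k y₂ g)                       ≈⟨ ≈k.+ᴹ-congʳ {LV.lincomb k y₂ g} gy₁≈0 ⟨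
            _⊕v_ F (LV.lincomb k y₁ g) (LV.lincomb k y₂ g)          ≈⟨ LV.lincomb-+ k y₁ y₂ g ⟨
            LV.lincomb k (_⊕v_ F y₁ y₂) g                           ≈⟨ LV.lincomb-cong k split≈0 (λ _ → ≈k.≈ᴹ-refl) ⟩
            LV.lincomb k (0v F) g                                   ≈⟨ LV.lincomb-zeroˡ k g (λ _ → refl) ⟩
            0v F                                                    ∎
            where
            open ≈-Reasoning
            y₁ y₂ : Vect F n
            y₁ = LV.lincomb n c₁ N
            y₂ = LV.lincomb n c₂ r
            gy₁≈0 : Kernel y₁
            gy₁≈0 = LV.lincomb-closed n Kernel-isSubspace (λ _ → tt) N∈
          c₁≡0 : ∀ i → c₁ i ≡ 0#
          c₁≡0 = N-ind c₁ (λ _ → tt) (≈n.≈ᴹ-trans (≈n.≈ᴹ-sym (≈n.+ᴹ-identityʳ _))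
            (≈n.≈ᴹ-trans (≈n.+ᴹ-congˡ {LV.lincomb n c₁ N} (≈n.≈ᴹ-sym (LV.lincomb-zeroˡ n r c₂≈0))) split≈0))
          vanish : (i : Fin e ⊎ Fin k) → c (Fin.join e k i) ≡ 0#
          vanish (inj₁ i) = c₁≡0 i
          vanish (inj₂ i) = c₂≈0 i

  -- The dual code as the kernel of H = GA

  module _ {k n : ℕ} {U : Vect F k → Set} {G : Fin k → Fin n → L F} (G-basis : KV.IsBasis k U (cols F G))
           {A : Fin n → Fin n → L F} (A∈GL : InGL F n A) where
    private
      module ≈k = IsLeftSemimodule (Vect-isLeftSemimodule k)
      module ≈-Reasoning = SetoidReasoning ≈k.≈ᴹ-setoid
      _≈_ = _≈v_ F {k}
      g = cols F G
      H = matMul F G A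
      K-A = proj₁ A∈GL
      B = proj₁ (proj₂ A∈GL)
      K-B = proj₁ (proj₂ (proj₂ A∈GL))
      AB≡δ = proj₁ (proj₂ (proj₂ (proj₂ A∈GL)))
      BA≡δ = proj₂ (proj₂ (proj₂ (proj₂ A∈GL)))

    cols-matMul : ∀ l → cols F H l ≈ KV.lincomb k (λ j → A j l) g
    cols-matMul l i = trans (∑-*-comm (G i) (λ j → A j l))
      (sym (trans (cong (λ v → v i) (KV≡LV (λ j → A j l) g)) (LV-lincomb (λ j → A j l) g i)))

    lincomb-matMul : ∀ c → KV.lincomb k c (cols F H) ≈ KV.lincomb k (λ j → ∑ F (λ l → c l ⊠ A j l)) g
    lincomb-matMul c = ≈k.≈ᴹ-trans (KV.lincomb-cong k (λ _ → refl) cols-matMul)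
      (KV.lincomb-lincomb k c (λ l j → A j l) g)

    -- `A` is invertible over K. BA = δ turns a relation on the columns of `H` into a trivial one,
    -- and AB = δ recovers the columns of `G` from those of `H`.
    basis-GL : KV.IsBasis k U (cols F H)
    basis-GL = H∈U , H-ind , (λ x Ux → KV.span-trans k {a = g} {cols F H} g∈H (proj₁ (proj₂ (proj₂ G-basis)) x Ux)) ,
      (λ x → KV.span-⊆ k U-sub H∈U x)
      where
      U-sub = KV.basis-isSubspace k G-basis
      H∈U : ∀ l → U (cols F H l)
      H∈U l = KV.resp {k} U-sub (≈k.≈ᴹ-sym (cols-matMul l))
        (KV.lincomb-closed k U-sub (λ j → K-A j l) (proj₁ G-basis))
      H-ind : KV.Independent k (cols F H)
      H-ind c Kc cH≈0 = left-inverse-injective B A BA≡δ c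
        (proj₁ (proj₂ G-basis) _ (λ j → FiniteSubfield.S-∑ subfieldK (λ l → FieldExt.K-* F (Kc l) (K-A j l)))
          (≈k.≈ᴹ-trans (≈k.≈ᴹ-sym (lincomb-matMul c)) cH≈0))
      g∈H : ∀ l → KV.InSpan k (cols F H) (g l)
      g∈H l = (λ j → B j l) , (λ j → K-B j l) , (begin
        KV.lincomb k (λ j → B j l) (cols F H)                       ≈⟨ lincomb-matMul (λ j → B j l) ⟩
        KV.lincomb k (λ i → ∑ F (λ j → B j l ⊠ A i j)) g            ≈⟨ KV.lincomb-cong k (λ i → trans (∑-*-comm (λ j → B j l) (A i)) (trans (AB≡δ i l) (δ-sym i l))) (λ _ → ≈k.≈ᴹ-refl) ⟩
        KV.lincomb k (δ F l) g                                      ≈⟨ KV.lincomb-δ k l g ⟩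
        g l                                                         ∎)
        where open ≈-Reasoning

    private
      syndrome : ∀ y i → LV.lincomb k y (cols F H) i ≡ ∑ F (λ l → H i l ⊠ y l)
      syndrome y i = trans (LV-lincomb y (cols F H) i) (∑-*-comm y (H i))

    -- The messages `δ F i` encode to the rows of `H`, and orthogonality to the rows is Hy = 0.
    dual⇒kernel : ∀ y → Dual F (CodeOf F G A) y → KernelCode.Kernel (cols F H) basis-GL y
    dual⇒kernel y y⊥ i = trans (syndrome y i) (trans (∑-cong (λ l → cong (_⊠ y l) (sym (row l))))
      (y⊥ (λ l → ∑ F (λ j → δ F i j ⊠ H j l)) (δ F i , λ _ → refl)))
      where
      row : ∀ l → ∑ F (λ j → δ F i j ⊠ H j l) ≡ H i l
      row l = trans (sym (KL-lincomb (δ F i) (λ j → H j l))) (KL.lincomb-δ i (λ j → H j l))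

    -- Moving brackets, (vH)y = v(Hy).
    kernel⇒dual : ∀ y → KernelCode.Kernel (cols F H) basis-GL y → Dual F (CodeOf F G A) y
    kernel⇒dual y Hy≈0 c (v , c≡vH) = begin
      ∑ F (λ l → c l ⊠ y l)                                 ≡⟨ ∑-cong (λ l → cong (_⊠ y l) (c≡vH l)) ⟩
      ∑ F (λ l → ∑ F (λ j → v j ⊠ H j l) ⊠ y l)             ≡⟨ KL-lincomb (λ l → ∑ F (λ j → v j ⊠ H j l)) y ⟨
      KL.lincomb (λ l → ∑ F (λ j → v j ⊠ H j l)) y          ≡⟨ KL.lincomb-lincomb v H y ⟨
      KL.lincomb v (λ j → KL.lincomb (H j) y)               ≡⟨ KL.lincomb-zeroʳ v (λ j → trans (KL-lincomb (H j) y) (trans (sym (syndrome y j)) (Hy≈0 j))) ⟩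
      0#                                                    ∎
      where open ≡-Reasoning

-- The ceiling in the rank defect, and the equivalence

-- Here `d` is the dimension n - k of the dual code. With km = n(h+1) + r, 0 ≤ r < n and t = m - h -
-- 1, one gets dm = tn - r, so the ceiling is `t`. The bound 2 + h ≤ m follows from n(h+1) ≤ km <
-- nm.
quasiMRD-distance : ∀ {m k h n d} → 1 ≤ m → n ≡ (k * m) / suc h → k < n → k * m < (2 + h) * n → d + k ≡ n →
  2 + h ≤ m × 2 + h + ceilDiv (d * m) n ≡ m + 1
quasiMRD-distance {m} {k} {h} {suc n′} {d} 1≤m n≡ k<n km< d+k≡n = h+1<m , (begin
  2 + h + (d * m + n′) / n     ≡⟨ cong (2 + h +_) quotient ⟩
  2 + h + t                    ≡⟨ ℕ.+-comm (2 + h) t ⟩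
  t + (2 + h)                  ≡⟨ ℕ.+-suc t (1 + h) ⟩
  suc (t + (1 + h))            ≡⟨ cong suc m≡ ⟩
  suc m                        ≡⟨ ℕ.+-comm 1 m ⟩
  m + 1                        ∎)
  where
  open ≡-Reasoning
  n = suc n′
  n[h+1]≤km : n * suc h ≤ k * m
  n[h+1]≤km = subst (λ x → x * suc h ≤ k * m) (sym n≡) (m/n*n≤m (k * m) (suc h))
  h+1<m : suc h < m
  h+1<m = ℕ.*-cancelˡ-< n (suc h) m (ℕ.≤-<-trans n[h+1]≤km (ℕ.*-monoˡ-< m {{>-nonZero 1≤m}} k<n))
  t = m ∸ suc h
  m≡ : t + suc h ≡ m
  m≡ = ℕ.m∸n+n≡m (ℕ.<⇒≤ h+1<m)
  r = k * m ∸ n * suc h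
  r+n[h+1]≡km : r + n * suc h ≡ k * m
  r+n[h+1]≡km = ℕ.m∸n+n≡m n[h+1]≤km
  r≤n′ : r ≤ n′
  r≤n′ = ℕ.≤-pred (ℕ.+-cancelʳ-< (n * suc h) r n (subst₂ _<_ (sym r+n[h+1]≡km)
    (cong (n +_) (ℕ.*-comm (suc h) n)) km<))
  -- Of the n - 1 added by `ceilDiv`, `r` completes dm to tn; the remaining `s` is below `n` and
  -- adds nothing to the quotient.
  s = n′ ∸ r
  dm+r≡tn : d * m + r ≡ t * n
  dm+r≡tn = ℕ.+-cancelʳ-≡ (n * suc h) (d * m + r) (t * n) (begin
    d * m + r + n * suc h      ≡⟨ ℕ.+-assoc (d * m) r (n * suc h) ⟩
    d * m + (r + n * suc h)    ≡⟨ cong (d * m +_) r+n[h+1]≡km ⟩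
    d * m + k * m              ≡⟨ ℕ.*-distribʳ-+ m d k ⟨
    (d + k) * m                ≡⟨ cong (_* m) d+k≡n ⟩
    n * m                      ≡⟨ cong (n *_) m≡ ⟨
    n * (t + suc h)            ≡⟨ ℕ.*-distribˡ-+ n t (suc h) ⟩
    n * t + n * suc h          ≡⟨ cong (_+ n * suc h) (ℕ.*-comm n t) ⟩
    t * n + n * suc h          ∎)
  quotient : (d * m + n′) / n ≡ t
  quotient = begin
    (d * m + n′) / n           ≡⟨ cong (λ x → (d * m + x) / n) (ℕ.m+[n∸m]≡n r≤n′) ⟨
    (d * m + (r + s)) / n      ≡⟨ cong (_/ n) (ℕ.+-assoc (d * m) r s) ⟨
    (d * m + r + s) / n        ≡⟨ cong (λ x → (x + s) / n) dm+r≡tn ⟩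
    (t * n + s) / n            ≡⟨ +-distrib-/-∣ˡ s (n∣m*n t) ⟩
    t * n / n + s / n          ≡⟨ cong₂ _+_ (m*n/n≡m t n) (m<n⇒m/n≡0 (s≤s (ℕ.m∸n≤m n′ r))) ⟩
    t + 0                      ≡⟨ ℕ.+-identityʳ t ⟩
    t                          ∎

theorem6p6 : (F : FieldExt) (q m k h n : ℕ) →
    IsPrimePower q → (Fin q ↔ Σ (L F) (K F)) → (Fin (q ^ m) ↔ L F) →
    1 ≤ m → 1 ≤ k → h < k → n ≡ (k * m) / suc h → k < n →
    k * m < (h + 2) * ((k * m) / suc h) →
    (U : Vect F k → Set) → IsSystem F n k U →
    (G : Fin k → Fin n → L F) → KonV.IsBasis F k U (cols F G) →
    (A : Fin n → Fin n → L F) → InGL F n A →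
    (QuasiMaxHScattered F m k h U ⇔ QuasiMRD F m n (Dual F (CodeOf F G A)))
theorem6p6 F q m k h n _ K-enum L-enum 1≤m _ h<k n≡ k<n km< U (_ , U-spans) G G-basis A A∈GL = mk⇔ to from
  where
  open FiniteFieldExt F q m K-enum L-enum
  open KernelCode {U = U} (cols F (matMul F G A)) (basis-GL G-basis A∈GL)
  D : Vect F n → Set
  D = Dual F (CodeOf F G A)
  toKernel : ∀ {y} → D y → Kernel y
  toKernel {y} = dual⇒kernel G-basis A∈GL y
  fromKernel : ∀ {y} → Kernel y → D y
  fromKernel {y} = kernel⇒dual G-basis A∈GL y
  km<[2+h]n : k * m < (2 + h) * n
  km<[2+h]n = subst₂ (λ x y → k * m < x * y) (ℕ.+-comm h 2) (sym n≡) km<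
  dim-D : ∃ λ e → LV.HasDim n Kernel e × e + k ≡ n
  dim-D = kernel-hasDim U-spans
  e = proj₁ dim-D
  D-hasDim : LV.HasDim n D e
  D-hasDim = LV.hasDim-resp n (λ _ → fromKernel) (λ _ → toKernel) (proj₁ (proj₂ dim-D))
  distance : 2 + h ≤ m × 2 + h + ceilDiv (e * m) n ≡ m + 1
  distance = quasiMRD-distance 1≤m n≡ k<n km<[2+h]n (proj₂ (proj₂ dim-D))

  to : QuasiMaxHScattered F m k h U → QuasiMRD F m n D
  to (scattered , _) = codeword (independent-L (proj₁ distance))
    where
    heavy : ∀ {z w} → NonZero F z → Kernel z → RankWeight F z w → 2 + h ≤ w
    heavy = scattered⇒heavy h<k (ℕ.<-trans h<k k<n) scattered
    codeword : Σ (Fin (2 + h) → L F) KL.Independent → QuasiMRD F m n D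
    -- `heavy` bounds the distance below. Since km < n(2+h), some nonzero codeword has its entries
    -- in the span of 2+h elements, so the bound is attained.
    codeword (u , u-ind) = minimal (codeword-in-span u u-ind (subst (k * m <_) (ℕ.*-comm (2 + h) n) km<[2+h]n))
      where
      minimal : (Σ (Vect F n) λ z → NonZero F z × Kernel z × ∀ l → KL.InSpan u (z l)) → QuasiMRD F m n D
      minimal (z , z≢0 , gz≈0 , z∈) = e , 2 + h , D-hasDim ,
        ((z , fromKernel gz≈0 , z≢0 , subst (RankWeight F z) w≡2+h rw) ,
          λ _ _ c∈ c≢0 → heavy c≢0 (toKernel c∈)) , proj₂ distance
        where
        w : ℕ
        w = proj₁ (rankWeight-exists z)
        rw : RankWeight F z w
        rw = proj₂ (rankWeight-exists z)
        w≡2+h : w ≡ 2 + h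
        w≡2+h = ℕ.≤-antisym (rankWeight-≤ {u = u} z∈ rw) (heavy z≢0 gz≈0 rw)

  from : QuasiMRD F m n D → QuasiMaxHScattered F m k h U
  from (e′ , d , D-hasDim′ , (_ , d-min) , distance′) =
    heavy⇒scattered heavy , subst (KonV.HasDim F k U) n≡ (cols F G , G-basis)
    where
    e′≡e : e′ ≡ e
    e′≡e = LV.dim-unique n {D} D-hasDim′ D-hasDim
    -- The dimension of the dual code is unique, so both defect equations contain the same ceiling,
    -- which cancels.
    d≡2+h : d ≡ 2 + h
    d≡2+h = ℕ.+-cancelʳ-≡ (ceilDiv (e * m) n) d (2 + h)
      (trans (subst (λ e → d + ceilDiv (e * m) n ≡ m + 1) e′≡e distance′) (sym (proj₂ distance)))
    heavy : ∀ {z w} → NonZero F z → Kernel z → RankWeight F z w → 2 + h ≤ w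
    heavy {z} {w} z≢0 gz≈0 rw = subst (_≤ w) d≡2+h (d-min z w (fromKernel gz≈0) z≢0 rw)
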